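{- $2.2818564 < \rho^*(\mathcal{B}_2) < 2.5823284$.
   Context: For a positive integer $n$, $[n]=\{1,\dots,n\}$ and $\mathcal{B}_n$ denotes the family of all subsets of $[n]$ ordered by inclusion; $\mathcal{B}_2$ is thus the 4-element Boolean lattice (the diamond). A family $\mathcal{F}\subseteq\mathcal{B}_n$ contains a copy of a poset $P$ if some subset of $\mathcal{F}$, with the order induced by inclusion, is isomorphic to $P$; otherwise $\mathcal{F}$ is $P$-free. The Lubell function is $\ell(\mathcal{F})=\sum_{A\in\mathcal{F}}1/\binom{n}{|A|}$. Define $\rho^*(P)=\limsup_{n\to\infty}\sup\{\ell(\mathcal{F}) : \emptyset\in\mathcal{F}\subseteq\mathcal{B}_n,\ \mathcal{F}\text{ is }P\text{ -free}\}$. -}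

module Defs where

open import Data.Nat using (ℕ; zero; suc; _≥_)
open import Data.Nat.Combinatorics using (_C_)
open import Data.Integer using (+_)
open import Data.Rational using (ℚ; 0ℚ; _+_; _/_; _≤_; _<_)
open import Data.Fin.Subset using (Subset; _⊆_; ∣_∣) renaming (⊥ to ∅)
open import Data.List using (List; []; _∷_)
open import Data.List.Membership.Propositional using (_∈_)
open import Data.List.Relation.Unary.Unique.Propositional using (Unique)
open import Data.Product using (Σ; _×_; ∃-syntax)
open import Function.Bundles using (_⇔_)
open import Relation.Nullary using (¬_)

-- 1 / m as a rational (with the harmless convention 1/0 = 0; only used for
-- binomial coefficients n C k with k ≤ n, which are ≥ 1).
inv : ℕ → ℚ
inv zero    = 0ℚ
inv (suc m) = + 1 / suc m

-- A family F ⊆ B_n is a duplicate-free list of subsets of [n] = Fin n.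
-- Lubell function ℓ(F) = Σ_{A ∈ F} 1 / (n choose |A|).
lubell : (n : ℕ) → List (Subset n) → ℚ
lubell n []      = 0ℚ
lubell n (A ∷ F) = inv (n C ∣ A ∣) + lubell n F

-- F contains a copy of the poset B_m: a map f : B_m → F which is an order
-- isomorphism onto its image (x ⊆ y ⇔ f x ⊆ f y; injectivity is implied,
-- but stated for clarity), i.e. the image with the induced order ≅ B_m.
ContainsCopyOfB : (m : ℕ) {n : ℕ} → List (Subset n) → Set
ContainsCopyOfB m {n} F =
  Σ (Subset m → Subset n) λ f →
    (∀ x → f x ∈ F) ×
    (∀ x y → (x ⊆ y) ⇔ (f x ⊆ f y))

Admissible : (n : ℕ) → List (Subset n) → Set
Admissible n F = Unique F × (∅ ∈ F) × ¬ ContainsCopyOfB 2 F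

-- c < ρ*(B_2), where ρ* = limsup_n max{ℓ(F) : F admissible in B_n}.
-- (limsup > c  iff  for some c' > c, the max is ≥ c' for infinitely many n.)
LowerBoundRhoStarDiamond : ℚ → Set
LowerBoundRhoStarDiamond c =
  ∃[ c' ] (c < c' × (∀ N → ∃[ n ] (n ≥ N × ∃[ F ] (Admissible n F × c' ≤ lubell n F))))

-- ρ*(B_2) < c.
-- (limsup < c  iff  for some c' < c, eventually every admissible F has ℓ(F) ≤ c'.)
UpperBoundRhoStarDiamond : ℚ → Set
UpperBoundRhoStarDiamond c =
  ∃[ c' ] (c' < c × ∃[ N ] (∀ n → n ≥ N → ∀ F → Admissible n F → lubell n F ≤ c'))

{-# OPTIONS --safe #-}
module Submission where

-- Upper bound.  Let L(A) be the Lubell function of the members of F below A, relative to A.  If A ∉ F then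
-- L(A) is the average of L(A ∖ {a}) over a ∈ A.  If A ∈ F then, ∅ being in F, two incomparable members below A
-- would complete a diamond; so the members below A form a chain, L(A) ≤ Σ_j 1/(|A| choose j), and at most one
-- singleton of F lies below A (if none does, the term j = 1 is missing).  By induction L(A) is bounded by a
-- function levelBound of |A|, |A ∩ S| and |A ∖ S|, where S is the union of the singletons of F.  At |A| = 8 it
-- is below 2.578, and from there on a maximum principle keeps L(A) below this value.
--
-- Lower bound.  Split the ground set into parts T₁, T₂, T₃ in the ratio 37 : 80 : 37 and take the sets meeting
-- (T₁, T₂, T₃) in (0,0,0), (1,0,0), (1,1,0), (0,2,0), (0,0,2), (1,1,1), (0,2,1) or (0,1,2) elements.
-- The members below any given one form a chain, and the Lubell function tends to 8333942 / 154³ = 2.28185640468….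

open import Defs
open import Data.Nat as ℕ using (ℕ; zero; suc; z≤n; s≤s; pred; _!)
import Data.Nat.Properties as ℕ
import Data.Nat.Solver as ℕSolver
open import Data.Nat.Combinatorics using (_C_; nCk+nC[k+1]≡[n+1]C[k+1]; nCn≡1; nC1≡n; k>n⇒nCk≡0)
open import Data.Nat.ListAction using (sum)
open import Data.Integer as ℤ using (+≤+)
import Data.Integer.Properties as ℤ
import Data.Integer.Solver as ℤSolver
open import Data.Rational using (ℚ; 0ℚ; 1ℚ; ½; _+_; _*_; _/_; _≤_; _⊔_; _≤?_; _<?_; toℚᵘ; nonNegative)
open import Data.Rational.Properties hiding (_≤?_; _<?_; _≟_)
open import Data.Rational.Solver using (module +-*-Solver)
open import Data.Rational.Unnormalised as ℚᵘ using (mkℚᵘ; _≃_; *≡*; *≤*)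
import Data.Rational.Unnormalised.Properties as ℚᵘ
open import Data.Bool using (true; false; if_then_else_)
open import Data.Bool.Properties using () renaming (_≟_ to _≟ᵇ_)
open import Data.Fin using (Fin; zero; suc; toℕ; fromℕ<)
import Data.Fin.Properties as Fin
open import Data.Fin.Subset using (Subset; _⊆_; ∣_∣; inside; outside; ⊤; _∩_; ∁; ⁅_⁆)
  renaming (⊥ to ∅; _∈_ to _∈ˢ_)
open import Data.Fin.Subset.Properties hiding (_∈?_)
open import Data.Vec as Vec using (Vec; []; _∷_; tabulate; here; there)
import Data.Vec.Properties as Vec
open import Data.List as List using (List; []; _∷_; [_]; _++_; map; length; concat; cartesianProductWith)
import Data.List.Properties as List
open import Data.List.Membership.Propositional using (_∈_; _∉_)
open import Data.List.Membership.Propositional.Properties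
import Data.List.Membership.DecPropositional as DecMembership
open import Data.List.Relation.Unary.All as All using (All; []; _∷_)
import Data.List.Relation.Unary.All.Properties as All
open import Data.List.Relation.Unary.Any using (here; there)
open import Data.List.Relation.Unary.AllPairs as AllPairs using ([]; _∷_)
import Data.List.Relation.Unary.AllPairs.Properties as AllPairs
open import Data.List.Relation.Unary.Unique.Propositional using (Unique)
import Data.List.Relation.Unary.Unique.Propositional.Properties as Unique
open import Data.Product using (∃; ∃₂; _×_; _,_; proj₁; proj₂)
import Data.Product.Properties as Product
open import Data.Sum using (_⊎_; inj₁; inj₂; [_,_]′)
open import Data.Empty using (⊥-elim)
open import Function using (_∘_)
open import Function.Bundles using (mk⇔; Equivalence)
open import Relation.Nullary using (Dec; yes; no; does; ¬_; contradiction)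
open import Relation.Nullary.Decidable using (toWitness; dec-true; dec-false; ¬?; _×-dec_; _⊎-dec_; _→-dec_)
open import Relation.Binary.PropositionalEquality hiding ([_])

private variable
  n : ℕ

-- Natural numbers and their reciprocals in the rationals

ι : ℕ → ℚ
ι m = ℤ.+ m / 1

toℚᵘ-/ : ∀ m d → toℚᵘ (ℤ.+ m / suc d) ≃ mkℚᵘ (ℤ.+ m) d
toℚᵘ-/ m d = toℚᵘ-fromℚᵘ (mkℚᵘ (ℤ.+ m) d)

ι-+ : ∀ m n → ι (m ℕ.+ n) ≡ ι m + ι n
ι-+ m n = toℚᵘ-injective (begin
  toℚᵘ (ι (m ℕ.+ n))                ≈⟨ toℚᵘ-/ (m ℕ.+ n) 0 ⟩
  mkℚᵘ (ℤ.+ (m ℕ.+ n)) 0              ≈⟨ *≡* (ℤSolver.+-*-Solver.solve 2 (λ m n → (m :+ n) :* con (ℤ.+ 1)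
       := (m :* con (ℤ.+ 1) :+ n :* con (ℤ.+ 1)) :* con (ℤ.+ 1))
       refl (ℤ.+ m) (ℤ.+ n)) ⟩
  mkℚᵘ (ℤ.+ m) 0 ℚᵘ.+ mkℚᵘ (ℤ.+ n) 0    ≈⟨ ℚᵘ.+-cong (toℚᵘ-/ m 0) (toℚᵘ-/ n 0) ⟨
  toℚᵘ (ι m) ℚᵘ.+ toℚᵘ (ι n)        ≈⟨ toℚᵘ-homo-+ (ι m) (ι n) ⟨
  toℚᵘ (ι m + ι n)                  ∎)
  where
  open ℚᵘ.≃-Reasoning
  open ℤSolver.+-*-Solver

ι-* : ∀ m n → ι (m ℕ.* n) ≡ ι m * ι n
ι-* m n = toℚᵘ-injective (begin
  toℚᵘ (ι (m ℕ.* n))                ≈⟨ toℚᵘ-/ (m ℕ.* n) 0 ⟩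
  mkℚᵘ (ℤ.+ (m ℕ.* n)) 0              ≈⟨ *≡* (cong (ℤ._* (ℤ.+ 1)) (ℤ.pos-* m n)) ⟩
  mkℚᵘ (ℤ.+ m) 0 ℚᵘ.* mkℚᵘ (ℤ.+ n) 0    ≈⟨ ℚᵘ.*-cong (toℚᵘ-/ m 0) (toℚᵘ-/ n 0) ⟨
  toℚᵘ (ι m) ℚᵘ.* toℚᵘ (ι n)        ≈⟨ toℚᵘ-homo-* (ι m) (ι n) ⟨
  toℚᵘ (ι m * ι n)                  ∎)
  where open ℚᵘ.≃-Reasoning

ι-mono-≤ : ∀ {m n} → m ℕ.≤ n → ι m ≤ ι n
ι-mono-≤ {m} {n} m≤n = toℚᵘ-cancel-≤ (begin
  toℚᵘ (ι m)    ≃⟨ toℚᵘ-/ m 0 ⟩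
  mkℚᵘ (ℤ.+ m) 0  ≤⟨ *≤* (ℤ.*-monoʳ-≤-nonNeg (ℤ.+ 1) (+≤+ m≤n)) ⟩
  mkℚᵘ (ℤ.+ n) 0  ≃⟨ toℚᵘ-/ n 0 ⟨
  toℚᵘ (ι n)    ∎)
  where open ℚᵘ.≤-Reasoning

inv-*-ι : ∀ n → .{{ℕ.NonZero n}} → inv n * ι n ≡ 1ℚ
inv-*-ι (suc n) = toℚᵘ-injective (begin
  toℚᵘ (inv (suc n) * ι (suc n))             ≈⟨ toℚᵘ-homo-* (inv (suc n)) (ι (suc n)) ⟩
  toℚᵘ (inv (suc n)) ℚᵘ.* toℚᵘ (ι (suc n))   ≈⟨ ℚᵘ.*-cong (toℚᵘ-/ 1 n) (toℚᵘ-/ (suc n) 0) ⟩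
  mkℚᵘ (ℤ.+ 1) n ℚᵘ.* mkℚᵘ (ℤ.+ suc n) 0         ≈⟨ *≡* (ℤSolver.+-*-Solver.solve 1 (λ n → (con (ℤ.+ 1) :* n) :* con (ℤ.+ 1)
       := con (ℤ.+ 1) :* (n :* con (ℤ.+ 1)))
       refl (ℤ.+ suc n)) ⟩
  toℚᵘ 1ℚ                                     ∎)
  where
  open ℚᵘ.≃-Reasoning
  open ℤSolver.+-*-Solver

inv≥0 : ∀ n → 0ℚ ≤ inv n
inv≥0 zero    = ≤-refl
inv≥0 (suc n) = toℚᵘ-cancel-≤ (begin
  toℚᵘ 0ℚ             ≤⟨ ℚᵘ.nonNegative⁻¹ (mkℚᵘ (ℤ.+ 1) n) ⟩
  mkℚᵘ (ℤ.+ 1) n        ≃⟨ toℚᵘ-/ 1 n ⟨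
  toℚᵘ (inv (suc n))  ∎)
  where open ℚᵘ.≤-Reasoning

inv-*-monoʳ-≤ : ∀ n {p q} → p ≤ q → inv n * p ≤ inv n * q
inv-*-monoʳ-≤ n = *-monoˡ-≤-nonNeg (inv n) {{nonNegative (inv≥0 n)}}

ι-*-monoʳ-≤ : ∀ n {p q} → p ≤ q → ι n * p ≤ ι n * q
ι-*-monoʳ-≤ n = *-monoˡ-≤-nonNeg (ι n) {{nonNegative (ι-mono-≤ {0} {n} z≤n)}}

-- Dividing d x = y z by x y z gives d / (y z) = 1 / x. This turns product identities between
-- binomial coefficients into identities between their reciprocals.
inv-cross : ∀ d x y z → .{{ℕ.NonZero x}} → .{{ℕ.NonZero y}} → .{{ℕ.NonZero z}} →
            d ℕ.* x ≡ y ℕ.* z → inv y * (ι d * inv z) ≡ inv x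
inv-cross d x y z eq = begin
  inv y * (ι d * inv z)                   ≡⟨ *-identityʳ _ ⟨
  inv y * (ι d * inv z) * 1ℚ              ≡⟨ cong (inv y * (ι d * inv z) *_) (inv-*-ι x) ⟨
  inv y * (ι d * inv z) * (inv x * ι x)   ≡⟨ solve 5 (λ y′ d z′ x′ x → y′ :* (d :* z′) :* (x′ :* x)
       := y′ :* z′ :* x′ :* (d :* x))
       refl (inv y) (ι d) (inv z) (inv x) (ι x) ⟩
  inv y * inv z * inv x * (ι d * ι x)     ≡⟨ cong (inv y * inv z * inv x *_) (trans (sym (ι-* d x)) (trans (cong ι eq) (ι-* y z))) ⟩
  inv y * inv z * inv x * (ι y * ι z)     ≡⟨ solve 5 (λ y′ z′ x′ y z → y′ :* z′ :* x′ :* (y :* z)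
       := (y′ :* y) :* (z′ :* z) :* x′)
       refl (inv y) (inv z) (inv x) (ι y) (ι z) ⟩
  inv y * ι y * (inv z * ι z) * inv x     ≡⟨ cong₂ (λ p q → p * q * inv x) (inv-*-ι y) (inv-*-ι z) ⟩
  1ℚ * 1ℚ * inv x                         ≡⟨ *-identityˡ (inv x) ⟩
  inv x                                   ∎
  where
  open ≡-Reasoning
  open +-*-Solver

-- Comparison of the fractions p/q and r/s by cross-multiplication.
ι*inv-mono-≤ : ∀ p q r s → .{{ℕ.NonZero q}} → .{{ℕ.NonZero s}} →
               p ℕ.* s ℕ.≤ r ℕ.* q → ι p * inv q ≤ ι r * inv s
ι*inv-mono-≤ p q r s ps≤rq = begin
  ι p * inv q                      ≡⟨ *-identityʳ _ ⟨
  ι p * inv q * 1ℚ                 ≡⟨ cong (ι p * inv q *_) (inv-*-ι s) ⟨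
  ι p * inv q * (inv s * ι s)      ≡⟨ solve 4 (λ p q′ s′ s → p :* q′ :* (s′ :* s) := q′ :* (s′ :* (p :* s)))
       refl (ι p) (inv q) (inv s) (ι s) ⟩
  inv q * (inv s * (ι p * ι s))    ≡⟨ cong (λ t → inv q * (inv s * t)) (ι-* p s) ⟨
  inv q * (inv s * ι (p ℕ.* s))    ≤⟨ inv-*-monoʳ-≤ q (inv-*-monoʳ-≤ s (ι-mono-≤ ps≤rq)) ⟩
  inv q * (inv s * ι (r ℕ.* q))    ≡⟨ cong (λ t → inv q * (inv s * t)) (ι-* r q) ⟩
  inv q * (inv s * (ι r * ι q))    ≡⟨ solve 4 (λ r q′ s′ q → q′ :* (s′ :* (r :* q)) := r :* s′ :* (q′ :* q))
       refl (ι r) (inv q) (inv s) (ι q) ⟩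
  ι r * inv s * (inv q * ι q)      ≡⟨ cong (ι r * inv s *_) (inv-*-ι q) ⟩
  ι r * inv s * 1ℚ                 ≡⟨ *-identityʳ _ ⟩
  ι r * inv s                      ∎
  where
  open ≤-Reasoning
  open +-*-Solver

-- Binomial coefficients

0C : ∀ k → 0 C suc k ≡ 0
0C k = k>n⇒nCk≡0 {0} {suc k} (s≤s z≤n)

-- The absorption identity, by induction on n through Pascal's rule.
[1+k]*[1+n]C[1+k]≡[1+n]*nCk : ∀ n k → suc k ℕ.* (suc n C suc k) ≡ suc n ℕ.* (n C k)
[1+k]*[1+n]C[1+k]≡[1+n]*nCk n zero = trans (ℕ.*-identityˡ _) (trans (nC1≡n (suc n)) (sym (ℕ.*-identityʳ (suc n))))
[1+k]*[1+n]C[1+k]≡[1+n]*nCk zero (suc k) rewrite k>n⇒nCk≡0 {1} {suc (suc k)} (s≤s (s≤s z≤n)) | 0C k = ℕ.*-zeroʳ k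
[1+k]*[1+n]C[1+k]≡[1+n]*nCk (suc n) (suc k) = begin
  suc (suc k) ℕ.* (suc (suc n) C suc (suc k))
    ≡⟨ cong (suc (suc k) ℕ.*_) (nCk+nC[k+1]≡[n+1]C[k+1] (suc n) (suc k)) ⟨
  suc (suc k) ℕ.* (C₁ ℕ.+ (suc n C suc (suc k)))
    ≡⟨ solve 3 (λ k a b → (con 2 :+ k) :* (a :+ b) := (con 1 :+ k) :* a :+ a :+ (con 2 :+ k) :* b)
         refl k C₁ (suc n C suc (suc k)) ⟩
  suc k ℕ.* C₁ ℕ.+ C₁ ℕ.+ suc (suc k) ℕ.* (suc n C suc (suc k))
    ≡⟨ cong₂ (λ x y → x ℕ.+ C₁ ℕ.+ y) ([1+k]*[1+n]C[1+k]≡[1+n]*nCk n k) ([1+k]*[1+n]C[1+k]≡[1+n]*nCk n (suc k)) ⟩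
  suc n ℕ.* (n C k) ℕ.+ C₁ ℕ.+ suc n ℕ.* (n C suc k)
    ≡⟨ solve 4 (λ n a b c → (con 1 :+ n) :* a :+ b :+ (con 1 :+ n) :* c := (con 1 :+ n) :* (a :+ c) :+ b)
         refl n (n C k) C₁ (n C suc k) ⟩
  suc n ℕ.* ((n C k) ℕ.+ (n C suc k)) ℕ.+ C₁
    ≡⟨ cong (λ x → suc n ℕ.* x ℕ.+ C₁) (nCk+nC[k+1]≡[n+1]C[k+1] n k) ⟩
  suc n ℕ.* C₁ ℕ.+ C₁
    ≡⟨ ℕ.+-comm (suc n ℕ.* C₁) C₁ ⟩
  suc (suc n) ℕ.* C₁ ∎
  where
  open ≡-Reasoning
  open ℕSolver.+-*-Solver
  C₁ = suc n C suc k

-- The companion of the absorption identity, with d standing for n + 1 - k. It follows by cancelling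
-- the absorption identity from Pascal's rule multiplied by n + 1.
d*[1+n]Ck≡[1+n]*nCk : ∀ d n k → d ℕ.+ k ≡ suc n → d ℕ.* (suc n C k) ≡ suc n ℕ.* (n C k)
d*[1+n]Ck≡[1+n]*nCk d n zero eq = cong (ℕ._* 1) (trans (sym (ℕ.+-identityʳ d)) eq)
d*[1+n]Ck≡[1+n]*nCk d n (suc k) eq = ℕ.+-cancelˡ-≡ (suc n ℕ.* (n C k)) _ _ (begin
  suc n ℕ.* (n C k) ℕ.+ d ℕ.* C₁         ≡⟨ cong (ℕ._+ d ℕ.* C₁) ([1+k]*[1+n]C[1+k]≡[1+n]*nCk n k) ⟨
  suc k ℕ.* C₁ ℕ.+ d ℕ.* C₁              ≡⟨ ℕ.*-distribʳ-+ C₁ (suc k) d ⟨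
  (suc k ℕ.+ d) ℕ.* C₁                   ≡⟨ cong₂ ℕ._*_ (trans (ℕ.+-comm (suc k) d) eq) (sym (nCk+nC[k+1]≡[n+1]C[k+1] n k)) ⟩
  suc n ℕ.* ((n C k) ℕ.+ (n C suc k))    ≡⟨ ℕ.*-distribˡ-+ (suc n) (n C k) (n C suc k) ⟩
  suc n ℕ.* (n C k) ℕ.+ suc n ℕ.* (n C suc k) ∎)
  where
  open ≡-Reasoning
  C₁ = suc n C suc k

nCk≢0 : ∀ {n k} → k ℕ.≤ n → ℕ.NonZero (n C k)
nCk≢0 {n} {zero} _ = _
nCk≢0 {suc n} {suc k} (s≤s k≤n) = ℕ.>-nonZero (begin-strict
  0                         <⟨ ℕ.>-nonZero⁻¹ _ {{nCk≢0 k≤n}} ⟩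
  n C k                     ≤⟨ ℕ.m≤m+n (n C k) (n C suc k) ⟩
  (n C k) ℕ.+ (n C suc k)   ≡⟨ nCk+nC[k+1]≡[n+1]C[k+1] n k ⟩
  suc n C suc k             ∎)
  where open ℕ.≤-Reasoning

-- The left side is the falling factorial n (n - 1) ... (n - k + 1). Absorption peels off its
-- leading factor, and the remaining ones are at most n.
k!*nCk≤n^k : ∀ n k → k ! ℕ.* (n C k) ℕ.≤ n ℕ.^ k
k!*nCk≤n^k n zero = ℕ.≤-refl
k!*nCk≤n^k zero (suc k) rewrite 0C k = ℕ.≤-reflexive (ℕ.*-zeroʳ (suc k !))
k!*nCk≤n^k (suc n) (suc k) = begin
  suc k ! ℕ.* (suc n C suc k)          ≡⟨ cong (ℕ._* (suc n C suc k)) (ℕ.*-comm (suc k) (k !)) ⟩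
  k ! ℕ.* suc k ℕ.* (suc n C suc k)    ≡⟨ ℕ.*-assoc (k !) (suc k) _ ⟩
  k ! ℕ.* (suc k ℕ.* (suc n C suc k))  ≡⟨ cong (k ! ℕ.*_) ([1+k]*[1+n]C[1+k]≡[1+n]*nCk n k) ⟩
  k ! ℕ.* (suc n ℕ.* (n C k))          ≡⟨ ℕ*.x∙yz≈y∙xz (k !) (suc n) (n C k) ⟩
  suc n ℕ.* (k ! ℕ.* (n C k))          ≤⟨ ℕ.*-monoʳ-≤ (suc n) (ℕ.≤-trans (k!*nCk≤n^k n k) (ℕ.^-monoˡ-≤ k (ℕ.n≤1+n n))) ⟩
  suc n ℕ.^ suc k                      ∎
  where
  open ℕ.≤-Reasoning
  import Algebra.Properties.CommutativeSemigroup ℕ.*-commutativeSemigroup as ℕ*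

-- Sums over the deletions of one element

-- sumDel A f = Σ_{a ∈ A} f (A ∖ {a})
sumDel : Subset n → (Subset n → ℚ) → ℚ
sumDel []            f = 0ℚ
sumDel (outside ∷ A) f = sumDel A (f ∘ (outside ∷_))
sumDel (inside  ∷ A) f = f (outside ∷ A) + sumDel A (f ∘ (inside ∷_))

-- Every argument of f in the sum has one element less than A. Recording this in the hypothesis is
-- what lets inductions on size use the comparison.
sumDel-mono-≤ : ∀ (A : Subset n) {f g} → (∀ A′ → suc ∣ A′ ∣ ≡ ∣ A ∣ → f A′ ≤ g A′) → sumDel A f ≤ sumDel A g
sumDel-mono-≤ []            f≤g = ≤-refl
sumDel-mono-≤ (outside ∷ A) f≤g = sumDel-mono-≤ A (λ A′ → f≤g (outside ∷ A′))
sumDel-mono-≤ (inside  ∷ A) f≤g =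
  +-mono-≤ (f≤g (outside ∷ A) refl) (sumDel-mono-≤ A (λ A′ → f≤g (inside ∷ A′) ∘ cong suc))

sumDel-cong : ∀ (A : Subset n) {f g} → (∀ A′ → suc ∣ A′ ∣ ≡ ∣ A ∣ → f A′ ≡ g A′) → sumDel A f ≡ sumDel A g
sumDel-cong A f≡g = ≤-antisym (sumDel-mono-≤ A (λ A′ → ≤-reflexive ∘ f≡g A′))
                              (sumDel-mono-≤ A (λ A′ → ≤-reflexive ∘ sym ∘ f≡g A′))

sumDel-+ : ∀ (A : Subset n) f g → sumDel A (λ A′ → f A′ + g A′) ≡ sumDel A f + sumDel A g
sumDel-+ []            f g = refl
sumDel-+ (outside ∷ A) f g = sumDel-+ A _ _
sumDel-+ (inside  ∷ A) f g = trans (cong (f A₀ + g A₀ +_) (sumDel-+ A _ _))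
  (solve 4 (λ a b c d → (a :+ b) :+ (c :+ d) := (a :+ c) :+ (b :+ d))
       refl (f A₀) (g A₀) (sumDel A (f ∘ (inside ∷_))) (sumDel A (g ∘ (inside ∷_))))
  where
  open +-*-Solver
  A₀ = outside ∷ A

1+ι : ∀ m c → c + ι m * c ≡ ι (suc m) * c
1+ι m c = trans (solve 2 (λ m c → c :+ m :* c := (con 1ℚ :+ m) :* c) refl (ι m) c) (cong (_* c) (sym (ι-+ 1 m)))
  where open +-*-Solver

sumDel-const : ∀ (A : Subset n) c → sumDel A (λ _ → c) ≡ ι ∣ A ∣ * c
sumDel-const []            c = sym (*-zeroˡ c)
sumDel-const (outside ∷ A) c = sumDel-const A c
sumDel-const (inside  ∷ A) c = trans (cong (c +_) (sumDel-const A c)) (1+ι ∣ A ∣ c)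

-- The successor of the predecessor differs from s only at s = 0, where the coefficient vanishes.
ι*-suc-pred : ∀ s (φ : ℕ → ℚ) → ι s * φ (suc (pred s)) ≡ ι s * φ s
ι*-suc-pred zero    φ = trans (*-zeroˡ (φ 1)) (sym (*-zeroˡ (φ 0)))
ι*-suc-pred (suc s) φ = refl

-- Of the elements of A, s lie in S and t outside it. Deleting one of the former lowers the first
-- count by one, deleting one of the latter the second.
sumDel-∩ : ∀ (A S : Subset n) (φ : ℕ → ℕ → ℚ) → let s = ∣ A ∩ S ∣ ; t = ∣ A ∩ ∁ S ∣ in
           sumDel A (λ A′ → φ ∣ A′ ∩ S ∣ ∣ A′ ∩ ∁ S ∣) ≡ ι s * φ (pred s) t + ι t * φ s (pred t)
sumDel-∩ [] [] φ = sym (trans (cong₂ _+_ (*-zeroˡ (φ 0 0)) (*-zeroˡ (φ 0 0))) refl)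
sumDel-∩ (outside ∷ A) (_ ∷ S) φ = sumDel-∩ A S φ
sumDel-∩ (inside ∷ A) (inside ∷ S) φ = begin
  φ s t + sumDel A (λ A′ → φ (suc ∣ A′ ∩ S ∣) ∣ A′ ∩ ∁ S ∣)
    ≡⟨ cong (φ s t +_) (sumDel-∩ A S (φ ∘ suc)) ⟩
  φ s t + (ι s * φ (suc (pred s)) t + ι t * φ (suc s) (pred t))
    ≡⟨ cong (λ x → φ s t + (x + ι t * φ (suc s) (pred t))) (ι*-suc-pred s (λ x → φ x t)) ⟩
  φ s t + (ι s * φ s t + ι t * φ (suc s) (pred t))
    ≡⟨ +-assoc (φ s t) _ _ ⟨
  φ s t + ι s * φ s t + ι t * φ (suc s) (pred t)
    ≡⟨ cong (_+ ι t * φ (suc s) (pred t)) (1+ι s (φ s t)) ⟩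
  ι (suc s) * φ s t + ι t * φ (suc s) (pred t) ∎
  where
  open ≡-Reasoning
  s = ∣ A ∩ S ∣
  t = ∣ A ∩ ∁ S ∣
sumDel-∩ (inside ∷ A) (outside ∷ S) φ = begin
  φ s t + sumDel A (λ A′ → φ ∣ A′ ∩ S ∣ (suc ∣ A′ ∩ ∁ S ∣))
    ≡⟨ cong (φ s t +_) (sumDel-∩ A S (λ x y → φ x (suc y))) ⟩
  φ s t + (ι s * φ (pred s) (suc t) + ι t * φ s (suc (pred t)))
    ≡⟨ cong (λ x → φ s t + (ι s * φ (pred s) (suc t) + x)) (ι*-suc-pred t (φ s)) ⟩
  φ s t + (ι s * φ (pred s) (suc t) + ι t * φ s t)
    ≡⟨ solve 3 (λ a b c → a :+ (b :+ c) := b :+ (a :+ c)) refl (φ s t) (ι s * φ (pred s) (suc t)) (ι t * φ s t) ⟩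
  ι s * φ (pred s) (suc t) + (φ s t + ι t * φ s t)
    ≡⟨ cong (ι s * φ (pred s) (suc t) +_) (1+ι t (φ s t)) ⟩
  ι s * φ (pred s) (suc t) + ι (suc t) * φ s t ∎
  where
  open ≡-Reasoning
  open +-*-Solver
  s = ∣ A ∩ S ∣
  t = ∣ A ∩ ∁ S ∣

-- For B inside A, the set B survives exactly those deletions whose element is outside B, and there
-- are |A| - |B| of them.
sumDel-⊆ : ∀ (A B : Subset n) c → sumDel A (λ A′ → if does (B ⊆? A′) then c else 0ℚ)
                                 ≡ (if does (B ⊆? A) then ι (∣ A ∣ ℕ.∸ ∣ B ∣) * c else 0ℚ)
sumDel-⊆ []            []            c = sym (*-zeroˡ c)
sumDel-⊆ (outside ∷ A) (outside ∷ B) c = sumDel-⊆ A B c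
sumDel-⊆ (outside ∷ A) (inside  ∷ B) c = trans (sumDel-const A 0ℚ) (*-zeroʳ (ι ∣ A ∣))
sumDel-⊆ (inside  ∷ A) (inside  ∷ B) c = trans (+-identityˡ _) (sumDel-⊆ A B c)
sumDel-⊆ (inside  ∷ A) (outside ∷ B) c rewrite sumDel-⊆ A B c with B ⊆? A
... | no _    = refl
-- The head is in A but not in B, so deleting it contributes one more c. As |B| is at most |A|, the
-- truncated subtraction is exact.
... | yes B⊆A = trans (1+ι (∣ A ∣ ℕ.∸ ∣ B ∣) c) (cong (λ x → ι x * c) (sym (ℕ.+-∸-assoc 1 (p⊆q⇒∣p∣≤∣q∣ B⊆A))))

-- The Lubell function below a set and its averaging property

p⊆q∧∣p∣≡∣q∣⇒p≡q : ∀ {p q : Subset n} → p ⊆ q → ∣ p ∣ ≡ ∣ q ∣ → p ≡ q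
p⊆q∧∣p∣≡∣q∣⇒p≡q {p = []}          {[]}          _   _  = refl
p⊆q∧∣p∣≡∣q∣⇒p≡q {p = outside ∷ p} {outside ∷ q} p⊆q eq = cong (outside ∷_) (p⊆q∧∣p∣≡∣q∣⇒p≡q (drop-∷-⊆ p⊆q) eq)
p⊆q∧∣p∣≡∣q∣⇒p≡q {p = inside ∷ p}  {inside ∷ q}  p⊆q eq = cong (inside ∷_) (p⊆q∧∣p∣≡∣q∣⇒p≡q (drop-∷-⊆ p⊆q) (ℕ.suc-injective eq))
p⊆q∧∣p∣≡∣q∣⇒p≡q {p = inside ∷ p}  {outside ∷ q} p⊆q eq = contradiction (p⊆q here) λ ()
p⊆q∧∣p∣≡∣q∣⇒p≡q {p = outside ∷ p} {inside ∷ q}  p⊆q eq =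
  contradiction (ℕ.≤-trans (ℕ.≤-reflexive (sym eq)) (p⊆q⇒∣p∣≤∣q∣ (drop-∷-⊆ p⊆q))) ℕ.1+n≰n

-- The probability that a uniformly random maximal chain from ∅ to A passes through B.
share : Subset n → Subset n → ℚ
share A B = if does (B ⊆? A) then inv (∣ A ∣ C ∣ B ∣) else 0ℚ

lubellBelow : List (Subset n) → Subset n → ℚ
lubellBelow []      A = 0ℚ
lubellBelow (B ∷ F) A = share A B + lubellBelow F A

-- A random maximal chain reaches A through a uniformly random deletion of one element, and whether
-- it meets B ≠ A is decided below that deletion. In numbers, 1 / (k+1 choose b) equals (k + 1 - b)
-- / ((k + 1) (k choose b)).
share-avg : ∀ {k} (A B : Subset n) → ∣ A ∣ ≡ suc k → B ≢ A →
            share A B ≡ inv (suc k) * sumDel A (λ A′ → share A′ B)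
share-avg {k = k} A B ∣A∣≡1+k B≢A = begin
  share A B
    ≡⟨ lemma ⟩
  inv (suc k) * (if does (B ⊆? A) then ι (∣ A ∣ ℕ.∸ ∣ B ∣) * inv (k C ∣ B ∣) else 0ℚ)
    ≡⟨ cong (inv (suc k) *_) (sumDel-⊆ A B (inv (k C ∣ B ∣))) ⟨
  inv (suc k) * sumDel A (λ A′ → if does (B ⊆? A′) then inv (k C ∣ B ∣) else 0ℚ)
    ≡⟨ cong (inv (suc k) *_) (sumDel-cong A λ A′ eq →
         cong (λ j → if does (B ⊆? A′) then inv (j C ∣ B ∣) else 0ℚ) (sym (ℕ.suc-injective (trans eq ∣A∣≡1+k)))) ⟩
  inv (suc k) * sumDel A (λ A′ → share A′ B) ∎
  where
  open ≡-Reasoning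
  lemma : share A B ≡ inv (suc k) * (if does (B ⊆? A) then ι (∣ A ∣ ℕ.∸ ∣ B ∣) * inv (k C ∣ B ∣) else 0ℚ)
  lemma with B ⊆? A
  ... | no _ = sym (*-zeroʳ (inv (suc k)))
  ... | yes B⊆A rewrite ∣A∣≡1+k = sym (inv-cross (suc k ℕ.∸ ∣ B ∣) (suc k C ∣ B ∣) (suc k) (k C ∣ B ∣)
            {{nCk≢0 (ℕ.m≤n⇒m≤1+n b≤k)}} {{_}} {{nCk≢0 b≤k}}
            (d*[1+n]Ck≡[1+n]*nCk (suc k ℕ.∸ ∣ B ∣) k ∣ B ∣ (ℕ.m∸n+n≡m (ℕ.m≤n⇒m≤1+n b≤k))))
    where
    b≤k : ∣ B ∣ ℕ.≤ k
    b≤k = ℕ.s≤s⁻¹ (subst (suc ∣ B ∣ ℕ.≤_) ∣A∣≡1+k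
            (ℕ.≤∧≢⇒< (p⊆q⇒∣p∣≤∣q∣ B⊆A) (B≢A ∘ p⊆q∧∣p∣≡∣q∣⇒p≡q B⊆A)))

lubellBelow-avg : ∀ {k} F (A : Subset n) → ∣ A ∣ ≡ suc k → A ∉ F →
                  lubellBelow F A ≡ inv (suc k) * sumDel A (lubellBelow F)
lubellBelow-avg {k = k} [] A _ _ = sym (trans (cong (inv (suc k) *_) (trans (sumDel-const A 0ℚ) (*-zeroʳ (ι ∣ A ∣)))) (*-zeroʳ (inv (suc k))))
lubellBelow-avg {k = k} (B ∷ F) A ∣A∣≡1+k A∉ = begin
  share A B + lubellBelow F A
    ≡⟨ cong₂ _+_ (share-avg A B ∣A∣≡1+k (A∉ ∘ here ∘ sym)) (lubellBelow-avg F A ∣A∣≡1+k (A∉ ∘ there)) ⟩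
  inv (suc k) * sumDel A (λ A′ → share A′ B) + inv (suc k) * sumDel A (lubellBelow F)
    ≡⟨ *-distribˡ-+ (inv (suc k)) _ _ ⟨
  inv (suc k) * (sumDel A (λ A′ → share A′ B) + sumDel A (lubellBelow F))
    ≡⟨ cong (inv (suc k) *_) (sumDel-+ A _ _) ⟨
  inv (suc k) * sumDel A (lubellBelow (B ∷ F)) ∎
  where open ≡-Reasoning

lubellBelow-⊤ : ∀ F → lubellBelow F (⊤ {n}) ≡ lubell n F
lubellBelow-⊤ [] = refl
lubellBelow-⊤ {n} (B ∷ F) = cong₂ _+_ lemma (lubellBelow-⊤ F)
  where
  lemma : share ⊤ B ≡ inv (n C ∣ B ∣)
  lemma rewrite dec-true (B ⊆? ⊤) ⊆⊤ | ∣⊤∣≡n n = refl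

-- Sums over levels

∑≤ : ℕ → (ℕ → ℚ) → ℚ
∑≤ zero    w = w 0
∑≤ (suc k) w = ∑≤ k w + w (suc k)

-- The weight w with its value at j replaced by 0. It serves to mark a level as already used and to
-- express that a level is empty.
except : ℕ → (ℕ → ℚ) → ℕ → ℚ
except j w i = if does (i ℕ.≟ j) then 0ℚ else w i

except-≢ : ∀ j w {i} → i ≢ j → except j w i ≡ w i
except-≢ j w {i} i≢j rewrite dec-false (i ℕ.≟ j) i≢j = refl

except-≡ : ∀ j w → except j w j ≡ 0ℚ
except-≡ j w rewrite dec-true (j ℕ.≟ j) refl = refl

∑≤-cong : ∀ k {v w} → (∀ {i} → i ℕ.≤ k → v i ≡ w i) → ∑≤ k v ≡ ∑≤ k w
∑≤-cong zero    v≡w = v≡w z≤n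
∑≤-cong (suc k) v≡w = cong₂ _+_ (∑≤-cong k (v≡w ∘ ℕ.m≤n⇒m≤1+n)) (v≡w ℕ.≤-refl)

∑≤-except : ∀ k j w → j ℕ.≤ k → ∑≤ k w ≡ w j + ∑≤ k (except j w)
∑≤-except zero zero w z≤n = sym (+-identityʳ (w 0))
∑≤-except (suc k) j w j≤1+k with j ℕ.≟ suc k
... | yes refl = begin
  ∑≤ k w + w (suc k)                              ≡⟨ +-comm _ (w (suc k)) ⟩
  w (suc k) + ∑≤ k w                              ≡⟨ cong (w (suc k) +_) (+-identityʳ (∑≤ k w)) ⟨
  w (suc k) + (∑≤ k w + 0ℚ)                       ≡⟨ cong (w (suc k) +_) (cong₂ _+_
                                                       (∑≤-cong k (λ i≤k → sym (except-≢ (suc k) w (ℕ.<⇒≢ (s≤s i≤k)))))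
                                                       (sym (except-≡ (suc k) w))) ⟩
  w (suc k) + ∑≤ (suc k) (except (suc k) w)       ∎
  where open ≡-Reasoning
... | no j≢1+k = begin
  ∑≤ k w + w (suc k)                              ≡⟨ cong₂ _+_ (∑≤-except k j w (ℕ.s≤s⁻¹ (ℕ.≤∧≢⇒< j≤1+k j≢1+k)))
                                                               (sym (except-≢ j w (j≢1+k ∘ sym))) ⟩
  w j + ∑≤ k (except j w) + except j w (suc k)    ≡⟨ +-assoc (w j) _ _ ⟩
  w j + ∑≤ (suc k) (except j w)                   ∎
  where open ≡-Reasoning

∑≤-nonNeg : ∀ k w → (∀ i → 0ℚ ≤ w i) → 0ℚ ≤ ∑≤ k w
∑≤-nonNeg zero    w 0≤w = 0≤w 0
∑≤-nonNeg (suc k) w 0≤w = +-mono-≤ (∑≤-nonNeg k w 0≤w) (0≤w (suc k))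

except-nonNeg : ∀ j w → (∀ i → 0ℚ ≤ w i) → ∀ i → 0ℚ ≤ except j w i
except-nonNeg j w 0≤w i with does (i ℕ.≟ j)
... | true  = ≤-refl
... | false = 0≤w i

-- What the estimate needs of the members below A forming a chain: there is at most one of each
-- size.
InjectiveSizesBelow : Subset n → List (Subset n) → Set
InjectiveSizesBelow A F = ∀ {B B′} → B ∈ F → B′ ∈ F → B ⊆ A → B′ ⊆ A → ∣ B ∣ ≡ ∣ B′ ∣ → B ≡ B′

-- Each member below A is charged to the term of its own size. The weight w is arbitrary so that the
-- induction on F can set a term to 0 once it has been charged.
lubellBelow-≤-∑ : ∀ (A : Subset n) F w → (∀ i → 0ℚ ≤ w i) → Unique F → InjectiveSizesBelow A F →
                  (∀ {B} → B ∈ F → B ⊆ A → inv (∣ A ∣ C ∣ B ∣) ≤ w ∣ B ∣) →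
                  lubellBelow F A ≤ ∑≤ ∣ A ∣ w
lubellBelow-≤-∑ A [] w 0≤w _ _ _ = ∑≤-nonNeg ∣ A ∣ w 0≤w
lubellBelow-≤-∑ A (B ∷ F) w 0≤w (B∉F ∷ F!) inj inv≤w with B ⊆? A
... | no _ = ≤-trans (≤-reflexive (+-identityˡ (lubellBelow F A)))
               (lubellBelow-≤-∑ A F w 0≤w F! (λ p q → inj (there p) (there q)) (inv≤w ∘ there))
... | yes B⊆A = begin
  inv (a C b) + lubellBelow F A
    ≤⟨ +-mono-≤ (inv≤w (here refl) B⊆A)
         (lubellBelow-≤-∑ A F (except b w) (except-nonNeg b w 0≤w) F! (λ p q → inj (there p) (there q))
           -- A later member below A of the same size as B would equal B, against uniqueness; so its
           -- weight is not the one set to 0.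
           λ {B′} B′∈F B′⊆A → ≤-trans (inv≤w (there B′∈F) B′⊆A) (≤-reflexive (sym (except-≢ b w λ eq →
             All.lookup B∉F B′∈F (inj (here refl) (there B′∈F) B⊆A B′⊆A (sym eq)))))) ⟩
  w b + ∑≤ a (except b w)
    ≡⟨ ∑≤-except a b w (p⊆q⇒∣p∣≤∣q∣ B⊆A) ⟨
  ∑≤ a w ∎
  where
  open ≤-Reasoning
  a = ∣ A ∣
  b = ∣ B ∣

-- Small subsets and diamonds below a member

∣p∣≡0⇒p≡⊥ : ∀ (p : Subset n) → ∣ p ∣ ≡ 0 → p ≡ ∅
∣p∣≡0⇒p≡⊥ []            _  = refl
∣p∣≡0⇒p≡⊥ (outside ∷ p) eq = cong (outside ∷_) (∣p∣≡0⇒p≡⊥ p eq)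

∣p∣≡1⇒p≡⁅x⁆ : ∀ (p : Subset n) → ∣ p ∣ ≡ 1 → ∃ λ x → p ≡ ⁅ x ⁆
∣p∣≡1⇒p≡⁅x⁆ (inside  ∷ p) eq = zero , cong (inside ∷_) (∣p∣≡0⇒p≡⊥ p (ℕ.suc-injective eq))
∣p∣≡1⇒p≡⁅x⁆ (outside ∷ p) eq = let x , p≡⁅x⁆ = ∣p∣≡1⇒p≡⁅x⁆ p eq in suc x , cong (outside ∷_) p≡⁅x⁆

x∈p⇒∣p∣≢0 : ∀ {p : Subset n} {x} → x ∈ˢ p → ∣ p ∣ ≢ 0
x∈p⇒∣p∣≢0 {p = p} x∈p ∣p∣≡0 = ∉⊥ (subst (_ ∈ˢ_) (∣p∣≡0⇒p≡⊥ p ∣p∣≡0) x∈p)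

∣p∣≢0⇒nonempty : ∀ (p : Subset n) {k} → ∣ p ∣ ≡ suc k → ∃ λ x → x ∈ˢ p
∣p∣≢0⇒nonempty (inside  ∷ p) _  = zero , here
∣p∣≢0⇒nonempty (outside ∷ p) eq = let x , x∈p = ∣p∣≢0⇒nonempty p eq in suc x , there x∈p

∣p∣≥2⇒two : ∀ (p : Subset n) {k} → ∣ p ∣ ≡ suc (suc k) → ∃₂ λ x y → x ∈ˢ p × y ∈ˢ p × x ≢ y
∣p∣≥2⇒two (inside  ∷ p) eq = let y , y∈p = ∣p∣≢0⇒nonempty p (ℕ.suc-injective eq) in zero , suc y , here , there y∈p , λ ()
∣p∣≥2⇒two (outside ∷ p) eq = let x , y , x∈p , y∈p , x≢y = ∣p∣≥2⇒two p eq in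
  suc x , suc y , there x∈p , there y∈p , x≢y ∘ Fin.suc-injective

x∈p⇒⁅x⁆⊆p : ∀ {p : Subset n} {x} → x ∈ˢ p → ⁅ x ⁆ ⊆ p
x∈p⇒⁅x⁆⊆p {x = x} x∈p y∈⁅x⁆ = subst (_∈ˢ _) (sym (x∈⁅y⁆⇒x≡y x y∈⁅x⁆)) x∈p

-- Distinct sets of equal size are incomparable, so two of them below A would form a diamond with ∅
-- as bottom and A as top.
injectiveSizesBelow : ∀ {F} → ∅ {n} ∈ F → ¬ ContainsCopyOfB 2 F → ∀ {A} → A ∈ F → InjectiveSizesBelow A F
injectiveSizesBelow {n} {F} ∅∈F ¬copy {A} A∈F {B} {B′} B∈F B′∈F B⊆A B′⊆A ∣B∣≡∣B′∣ with Vec.≡-dec _≟ᵇ_ B B′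
... | yes B≡B′ = B≡B′
... | no  B≢B′ = contradiction (f , f∈F , λ x y → mk⇔ (mono x y) (cancel x y)) ¬copy
  where
  B⊈B′ : ¬ B ⊆ B′
  B⊈B′ B⊆B′ = B≢B′ (p⊆q∧∣p∣≡∣q∣⇒p≡q B⊆B′ ∣B∣≡∣B′∣)
  B′⊈B : ¬ B′ ⊆ B
  B′⊈B B′⊆B = B≢B′ (sym (p⊆q∧∣p∣≡∣q∣⇒p≡q B′⊆B (sym ∣B∣≡∣B′∣)))

  f : Subset 2 → Subset n
  f (outside ∷ outside ∷ []) = ∅
  f (inside  ∷ outside ∷ []) = B
  f (outside ∷ inside  ∷ []) = B′
  f (inside  ∷ inside  ∷ []) = A

  f∈F : ∀ x → f x ∈ F
  f∈F (outside ∷ outside ∷ []) = ∅∈F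
  f∈F (inside  ∷ outside ∷ []) = B∈F
  f∈F (outside ∷ inside  ∷ []) = B′∈F
  f∈F (inside  ∷ inside  ∷ []) = A∈F

  mono : ∀ x y → x ⊆ y → f x ⊆ f y
  mono (outside ∷ outside ∷ []) _ _ = ⊥⊆
  mono (inside  ∷ outside ∷ []) (inside  ∷ outside ∷ []) _ = ⊆-refl
  mono (inside  ∷ outside ∷ []) (inside  ∷ inside  ∷ []) _ = B⊆A
  mono (outside ∷ inside  ∷ []) (outside ∷ inside  ∷ []) _ = ⊆-refl
  mono (outside ∷ inside  ∷ []) (inside  ∷ inside  ∷ []) _ = B′⊆A
  mono (inside  ∷ inside  ∷ []) (inside  ∷ inside  ∷ []) _ = ⊆-refl
  mono (inside  ∷ _ ∷ []) (outside ∷ _ ∷ []) x⊆y = contradiction (x⊆y here) λ ()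
  mono (_ ∷ inside  ∷ []) (_ ∷ outside ∷ []) x⊆y = contradiction (x⊆y (there here)) λ { (there ()) }

  cancel : ∀ x y → f x ⊆ f y → x ⊆ y
  cancel (outside ∷ outside ∷ []) _ _ = ⊥⊆
  cancel _ (inside  ∷ inside  ∷ []) _ = ⊆⊤
  cancel (inside  ∷ outside ∷ []) (inside  ∷ outside ∷ []) _ = ⊆-refl
  cancel (outside ∷ inside  ∷ []) (outside ∷ inside  ∷ []) _ = ⊆-refl
  -- In each remaining case the assumed inclusion would make B and B′ comparable.
  cancel (inside  ∷ outside ∷ []) (outside ∷ inside  ∷ []) B⊆B′ = ⊥-elim (B⊈B′ B⊆B′)
  cancel (outside ∷ inside  ∷ []) (inside  ∷ outside ∷ []) B′⊆B = ⊥-elim (B′⊈B B′⊆B)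
  cancel (inside  ∷ outside ∷ []) (outside ∷ outside ∷ []) B⊆∅ = ⊥-elim (B⊈B′ (⊆-trans B⊆∅ ⊥⊆))
  cancel (outside ∷ inside  ∷ []) (outside ∷ outside ∷ []) B′⊆∅ = ⊥-elim (B′⊈B (⊆-trans B′⊆∅ ⊥⊆))
  cancel (inside  ∷ inside  ∷ []) (outside ∷ outside ∷ []) A⊆∅ = ⊥-elim (B⊈B′ (⊆-trans B⊆A (⊆-trans A⊆∅ ⊥⊆)))
  cancel (inside  ∷ inside  ∷ []) (inside  ∷ outside ∷ []) A⊆B = ⊥-elim (B′⊈B (⊆-trans B′⊆A A⊆B))
  cancel (inside  ∷ inside  ∷ []) (outside ∷ inside  ∷ []) A⊆B′ = ⊥-elim (B⊈B′ (⊆-trans B⊆A A⊆B′))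

∣p∩q∣+∣p∩∁q∣≡∣p∣ : ∀ (p q : Subset n) → ∣ p ∩ q ∣ ℕ.+ ∣ p ∩ ∁ q ∣ ≡ ∣ p ∣
∣p∩q∣+∣p∩∁q∣≡∣p∣ []            []            = refl
∣p∩q∣+∣p∩∁q∣≡∣p∣ (outside ∷ p) (_       ∷ q) = ∣p∩q∣+∣p∩∁q∣≡∣p∣ p q
∣p∩q∣+∣p∩∁q∣≡∣p∣ (inside  ∷ p) (inside  ∷ q) = cong suc (∣p∩q∣+∣p∩∁q∣≡∣p∣ p q)
∣p∩q∣+∣p∩∁q∣≡∣p∣ (inside  ∷ p) (outside ∷ q) = trans (ℕ.+-suc _ _) (cong suc (∣p∩q∣+∣p∩∁q∣≡∣p∣ p q))

module _ {n : ℕ} where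
  open DecMembership (Vec.≡-dec {n = n} _≟ᵇ_) public using (_∈?_)

-- Singletons of the family and the bound by levels

singletonsOf : List (Subset n) → Subset n
singletonsOf F = tabulate (λ x → does (⁅ x ⁆ ∈? F))

∈-singletonsOf⁻ : ∀ F {x : Fin n} → x ∈ˢ singletonsOf F → ⁅ x ⁆ ∈ F
∈-singletonsOf⁻ F {x} x∈S with ⁅ x ⁆ ∈? F | trans (sym (Vec.lookup∘tabulate (λ x → does (⁅ x ⁆ ∈? F)) x)) (Vec.[]=⇒lookup x∈S)
... | yes ⁅x⁆∈F | _ = ⁅x⁆∈F

∈-singletonsOf⁺ : ∀ F {x : Fin n} → ⁅ x ⁆ ∈ F → x ∈ˢ singletonsOf F
∈-singletonsOf⁺ F {x} ⁅x⁆∈F = Vec.lookup⇒[]= x _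
  (trans (Vec.lookup∘tabulate (λ x → does (⁅ x ⁆ ∈? F)) x) (dec-true (⁅ x ⁆ ∈? F) ⁅x⁆∈F))

-- s counts the singletons of F below a member of F, so the case s ≥ 2 does not occur.
chainBound : (k s : ℕ) → ℚ
chainBound k zero          = ∑≤ k (except 1 (λ j → inv (k C j)))
chainBound k (suc zero)    = ∑≤ k (λ j → inv (k C j))
chainBound k (suc (suc _)) = 0ℚ

lubellBelow-≤-∑inv : ∀ F → Unique F → ∅ ∈ F → ¬ ContainsCopyOfB 2 F → ∀ (A : Subset n) → A ∈ F →
                    lubellBelow F A ≤ ∑≤ ∣ A ∣ (λ j → inv (∣ A ∣ C j))
lubellBelow-≤-∑inv F F! ∅∈F ¬copy A A∈F =
  lubellBelow-≤-∑ A F _ (λ j → inv≥0 (∣ A ∣ C j)) F! (injectiveSizesBelow ∅∈F ¬copy A∈F) (λ _ _ → ≤-refl)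

lubellBelow-≤-chainBound : ∀ F → Unique F → ∅ ∈ F → ¬ ContainsCopyOfB 2 F → ∀ (A : Subset n) → A ∈ F →
                           lubellBelow F A ≤ chainBound ∣ A ∣ ∣ A ∩ singletonsOf F ∣
lubellBelow-≤-chainBound F F! ∅∈F ¬copy A A∈F with ∣ A ∩ singletonsOf F ∣ in eq
... | suc zero = lubellBelow-≤-∑inv F F! ∅∈F ¬copy A A∈F
... | zero = lubellBelow-≤-∑ A F (except 1 w) (except-nonNeg 1 w (λ j → inv≥0 (∣ A ∣ C j))) F!
               (injectiveSizesBelow ∅∈F ¬copy A∈F)
               (λ {B} B∈F B⊆A → ≤-reflexive (sym (except-≢ 1 w (∣B∣≢1 B∈F B⊆A))))
  where
  w = λ j → inv (∣ A ∣ C j)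
  ∣B∣≢1 : ∀ {B} → B ∈ F → B ⊆ A → ∣ B ∣ ≢ 1
  ∣B∣≢1 {B} B∈F B⊆A ∣B∣≡1 with x , refl ← ∣p∣≡1⇒p≡⁅x⁆ B ∣B∣≡1 =
    x∈p⇒∣p∣≢0 (x∈p∩q⁺ (B⊆A (x∈⁅x⁆ x) , ∈-singletonsOf⁺ F B∈F)) eq
... | suc (suc _) = contradiction ⁅x⁆≡⁅y⁆ λ eq → x≢y (x∈⁅y⁆⇒x≡y y (subst (x ∈ˢ_) eq (x∈⁅x⁆ x)))
  where
  S = singletonsOf F
  two = ∣p∣≥2⇒two (A ∩ S) eq
  x = proj₁ two
  y = proj₁ (proj₂ two)
  x∈ = x∈p∩q⁻ A S (proj₁ (proj₂ (proj₂ two)))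
  y∈ = x∈p∩q⁻ A S (proj₁ (proj₂ (proj₂ (proj₂ two))))
  x≢y = proj₂ (proj₂ (proj₂ (proj₂ two)))
  ⁅x⁆≡⁅y⁆ : ⁅ x ⁆ ≡ ⁅ y ⁆
  ⁅x⁆≡⁅y⁆ = injectiveSizesBelow ∅∈F ¬copy A∈F
    (∈-singletonsOf⁻ F (proj₂ x∈)) (∈-singletonsOf⁻ F (proj₂ y∈))
    (x∈p⇒⁅x⁆⊆p (proj₁ x∈)) (x∈p⇒⁅x⁆⊆p (proj₁ y∈)) (trans (∣⁅x⁆∣≡1 x) (sym (∣⁅x⁆∣≡1 y)))

-- The two bounds are those for A ∈ F and for A ∉ F; where pred is applied to 0, the coefficient vanishes.
levelBound : (k s t : ℕ) → ℚ
levelBound zero    s t = 1ℚ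
levelBound (suc k) s t =
  chainBound (suc k) s ⊔ inv (suc k) * (ι s * levelBound k (pred s) t + ι t * levelBound k s (pred t))

-- Induction on the size of A along the recursion of `levelBound`: a member is bounded by its chain,
-- and a non-member is an average over deletions, which `sumDel-∩` sorts by whether the deleted
-- element lies in S.
lubellBelow-≤-levelBound : ∀ F → Unique F → ∅ ∈ F → ¬ ContainsCopyOfB 2 F → ∀ k (A : Subset n) → ∣ A ∣ ≡ k →
                  let S = singletonsOf F in lubellBelow F A ≤ levelBound k ∣ A ∩ S ∣ ∣ A ∩ ∁ S ∣
lubellBelow-≤-levelBound F F! ∅∈F ¬copy zero A eq =
  -- Here A is ∅, a member of F, and the sum over levels is the single term 1.
  ≤-trans (lubellBelow-≤-∑inv F F! ∅∈F ¬copy A (subst (_∈ F) (sym (∣p∣≡0⇒p≡⊥ A eq)) ∅∈F))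
          (≤-reflexive (cong (λ a → ∑≤ a (λ j → inv (a C j))) eq))
lubellBelow-≤-levelBound F F! ∅∈F ¬copy (suc k) A eq with A ∈? F
... | yes A∈F = ≤-trans (lubellBelow-≤-chainBound F F! ∅∈F ¬copy A A∈F)
                  (≤-trans (≤-reflexive (cong (λ a → chainBound a ∣ A ∩ singletonsOf F ∣) eq)) (p≤p⊔q _ _))
... | no A∉F = begin
  lubellBelow F A
    ≡⟨ lubellBelow-avg F A eq A∉F ⟩
  inv (suc k) * sumDel A (lubellBelow F)
    ≤⟨ inv-*-monoʳ-≤ (suc k) (sumDel-mono-≤ A λ A′ eq′ →
         lubellBelow-≤-levelBound F F! ∅∈F ¬copy k A′ (ℕ.suc-injective (trans eq′ eq))) ⟩
  inv (suc k) * sumDel A (λ A′ → levelBound k ∣ A′ ∩ S ∣ ∣ A′ ∩ ∁ S ∣)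
    ≡⟨ cong (inv (suc k) *_) (sumDel-∩ A S (levelBound k)) ⟩
  inv (suc k) * (ι s * levelBound k (pred s) t + ι t * levelBound k s (pred t))
    ≤⟨ p≤q⊔p (chainBound (suc k) s) _ ⟩
  levelBound (suc k) s t ∎
  where
  open ≤-Reasoning
  S = singletonsOf F
  s = ∣ A ∩ S ∣
  t = ∣ A ∩ ∁ S ∣

-- The value 2.578 lies above every entry of `levelBound` at level 8 and below 2.5823284. It also
-- exceeds 9/4, as the induction in `∑inv≤c₀` requires.
c₀ : ℚ
c₀ = ℤ.+ 2578 / 1000

-- Since s + t = 8, only the nine pairs (s, 8 - s) occur. They are settled by evaluation; the
-- remainder of the proof moves s into `Fin 9`.
levelBound≤c₀ : ∀ {k} → k ≡ 8 → ∀ s t → s ℕ.+ t ≡ k → levelBound k s t ≤ c₀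
levelBound≤c₀ refl s t s+t≡8 = subst₂ (λ s t → levelBound 8 s t ≤ c₀) (Fin.toℕ-fromℕ< s<9)
  (trans (cong (8 ℕ.∸_) (Fin.toℕ-fromℕ< s<9)) (trans (cong (ℕ._∸ s) (sym s+t≡8)) (ℕ.m+n∸m≡n s t)))
  (toWitness {a? = Fin.all? (λ (i : Fin 9) → levelBound 8 (toℕ i) (8 ℕ.∸ toℕ i) ≤? c₀)} _ (fromℕ< s<9))
  where
  s<9 : s ℕ.< 9
  s<9 = s≤s (subst (s ℕ.≤_) s+t≡8 (ℕ.m≤m+n s t))

-- Sums of reciprocal binomial coefficients and the maximum principle

∑≤-suc : ∀ k w → ∑≤ (suc k) w ≡ w 0 + ∑≤ k (w ∘ suc)
∑≤-suc zero    w = refl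
∑≤-suc (suc k) w = trans (cong (_+ w (suc (suc k))) (∑≤-suc k w)) (+-assoc (w 0) _ _)

∑≤-+ : ∀ k v w → ∑≤ k (λ i → v i + w i) ≡ ∑≤ k v + ∑≤ k w
∑≤-+ zero    v w = refl
∑≤-+ (suc k) v w = trans (cong (_+ (v (suc k) + w (suc k))) (∑≤-+ k v w))
  (solve 4 (λ a b c d → (a :+ b) :+ (c :+ d) := (a :+ c) :+ (b :+ d)) refl (∑≤ k v) (∑≤ k w) (v (suc k)) (w (suc k)))
  where open +-*-Solver

∑≤-distribˡ : ∀ k c w → ∑≤ k (λ i → c * w i) ≡ c * ∑≤ k w
∑≤-distribˡ zero    c w = refl
∑≤-distribˡ (suc k) c w = trans (cong (_+ c * w (suc k)) (∑≤-distribˡ k c w)) (sym (*-distribˡ-+ c _ _))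

∑inv : ℕ → ℚ
∑inv k = ∑≤ k (λ j → inv (k C j))

-- A Pascal rule for reciprocals. Over the common denominator (k + 1) (k choose j) the two
-- numerators are k + 1 - j and j + 1, with sum k + 2.
inv-Pascal : ∀ k j → j ℕ.≤ k → inv (suc k C j) + inv (suc k C suc j) ≡ inv (suc k) * ι (suc (suc k)) * inv (k C j)
inv-Pascal k j j≤k = begin
  inv (suc k C j) + inv (suc k C suc j)
    ≡⟨ cong₂ _+_
         (inv-cross (suc k ℕ.∸ j) (suc k C j) (suc k) (k C j) {{nCk≢0 (ℕ.m≤n⇒m≤1+n j≤k)}} {{_}} {{nCk≢0 j≤k}}
           (d*[1+n]Ck≡[1+n]*nCk (suc k ℕ.∸ j) k j (ℕ.m∸n+n≡m (ℕ.m≤n⇒m≤1+n j≤k))))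
         (inv-cross (suc j) (suc k C suc j) (suc k) (k C j) {{nCk≢0 (s≤s j≤k)}} {{_}} {{nCk≢0 j≤k}}
           ([1+k]*[1+n]C[1+k]≡[1+n]*nCk k j)) ⟨
  inv (suc k) * (ι (suc k ℕ.∸ j) * inv (k C j)) + inv (suc k) * (ι (suc j) * inv (k C j))
    ≡⟨ solve 4 (λ a b c d → a :* (b :* d) :+ a :* (c :* d) := a :* (b :+ c) :* d)
         refl (inv (suc k)) (ι (suc k ℕ.∸ j)) (ι (suc j)) (inv (k C j)) ⟩
  inv (suc k) * (ι (suc k ℕ.∸ j) + ι (suc j)) * inv (k C j)
    ≡⟨ cong (λ x → inv (suc k) * x * inv (k C j)) (trans (sym (ι-+ (suc k ℕ.∸ j) (suc j)))
         (cong ι (trans (ℕ.+-suc (suc k ℕ.∸ j) j) (cong suc (ℕ.m∸n+n≡m (ℕ.m≤n⇒m≤1+n j≤k)))))) ⟩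
  inv (suc k) * ι (suc (suc k)) * inv (k C j) ∎
  where
  open ≡-Reasoning
  open +-*-Solver

-- Write the sum twice, splitting off the last term of one copy and the first term of the other,
-- both equal to 1. The remaining terms pair up as neighbours, to which `inv-Pascal` applies.
∑inv-suc : ∀ k → ∑inv (suc k) ≡ 1ℚ + ½ * (inv (suc k) * ι (suc (suc k)) * ∑inv k)
∑inv-suc k = begin
  ∑inv (suc k)
    ≡⟨ solve 1 (λ x → x := con ½ :* (x :+ x)) refl (∑inv (suc k)) ⟩
  ½ * (∑inv (suc k) + ∑inv (suc k))
    ≡⟨ cong (λ x → ½ * (∑inv (suc k) + x)) (∑≤-suc k (λ j → inv (suc k C j))) ⟩
  ½ * ((l + inv (suc k C suc k)) + (1ℚ + r))
    ≡⟨ cong (λ x → ½ * ((l + inv x) + (1ℚ + r))) (nCn≡1 (suc k)) ⟩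
  ½ * ((l + 1ℚ) + (1ℚ + r))
    ≡⟨ solve 2 (λ l r → con ½ :* ((l :+ con 1ℚ) :+ (con 1ℚ :+ r)) := con 1ℚ :+ con ½ :* (l :+ r)) refl l r ⟩
  1ℚ + ½ * (l + r)
    ≡⟨ cong (λ x → 1ℚ + ½ * x) (trans (sym (∑≤-+ k _ _)) (trans (∑≤-cong k (λ {j} → inv-Pascal k j))
         (∑≤-distribˡ k (inv (suc k) * ι (suc (suc k))) (λ j → inv (k C j))))) ⟩
  1ℚ + ½ * (inv (suc k) * ι (suc (suc k)) * ∑inv k) ∎
  where
  open ≡-Reasoning
  open +-*-Solver
  l = ∑≤ k (λ j → inv (suc k C j))
  r = ∑≤ k (λ j → inv (suc k C suc j))

-- From level 8 on the factor (k + 2) / (k + 1) of the recurrence is at most 10/9, and x ↦ 1 + (5/9)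
-- x does not lead above c₀.
∑inv≤c₀ : ∀ d → ∑inv (d ℕ.+ 8) ≤ c₀
∑inv≤c₀ zero    = toWitness {a? = ∑inv 8 ≤? c₀} _
∑inv≤c₀ (suc d) = begin
  ∑inv (suc k)
    ≡⟨ ∑inv-suc k ⟩
  1ℚ + ½ * (inv (suc k) * ι (suc (suc k)) * ∑inv k)
    ≡⟨ cong (λ x → 1ℚ + ½ * (x * ∑inv k)) (*-comm (inv (suc k)) _) ⟩
  1ℚ + ½ * (ι (suc (suc k)) * inv (suc k) * ∑inv k)
    ≤⟨ +-monoʳ-≤ 1ℚ (*-monoˡ-≤-nonNeg ½ (≤-trans
         (*-monoʳ-≤-nonNeg (∑inv k) {{nonNegative (∑≤-nonNeg k _ (λ j → inv≥0 (k C j)))}} ratio)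
         (*-monoˡ-≤-nonNeg (ι 10 * inv 9) (∑inv≤c₀ d)))) ⟩
  1ℚ + ½ * (ι 10 * inv 9 * c₀)
    -- This amounts to c₀ being at least 9/4.
    ≤⟨ toWitness {a? = (1ℚ + ½ * (ι 10 * inv 9 * c₀)) ≤? c₀} _ ⟩
  c₀ ∎
  where
  open ≤-Reasoning
  k = d ℕ.+ 8
  eq : suc (suc k) ℕ.* 9 ℕ.+ d ≡ 10 ℕ.* suc k
  eq = solve 1 (λ d → (con 2 :+ (d :+ con 8)) :* con 9 :+ d := con 10 :* (con 1 :+ (d :+ con 8))) refl d
    where open ℕSolver.+-*-Solver
  ratio : ι (suc (suc k)) * inv (suc k) ≤ ι 10 * inv 9
  ratio = ι*inv-mono-≤ (suc (suc k)) (suc k) 10 9 (ℕ.≤-trans (ℕ.m≤m+n _ d) (ℕ.≤-reflexive eq))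

-- A non-member takes the average of values one level lower, so no new maximum arises there; a
-- member is bounded by the sum of reciprocal binomial coefficients.
lubellBelow-≤-max : ∀ F → Unique F → ∅ ∈ F → ¬ ContainsCopyOfB 2 F → ∀ K c →
                    (∀ (A : Subset n) → ∣ A ∣ ≡ K → lubellBelow F A ≤ c) → (∀ d → ∑inv (d ℕ.+ K) ≤ c) →
                    ∀ d (A : Subset n) → ∣ A ∣ ≡ d ℕ.+ K → lubellBelow F A ≤ c
lubellBelow-≤-max F F! ∅∈F ¬copy K c base ∑inv≤c zero A eq = base A eq
lubellBelow-≤-max F F! ∅∈F ¬copy K c base ∑inv≤c (suc d) A eq with A ∈? F
... | yes A∈F = ≤-trans (lubellBelow-≤-∑inv F F! ∅∈F ¬copy A A∈F)
                  (≤-trans (≤-reflexive (cong ∑inv eq)) (∑inv≤c (suc d)))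
... | no A∉F = begin
  lubellBelow F A
    ≡⟨ lubellBelow-avg F A eq A∉F ⟩
  inv (suc k) * sumDel A (lubellBelow F)
    ≤⟨ inv-*-monoʳ-≤ (suc k) (sumDel-mono-≤ A λ A′ eq′ →
         lubellBelow-≤-max F F! ∅∈F ¬copy K c base ∑inv≤c d A′ (ℕ.suc-injective (trans eq′ eq))) ⟩
  inv (suc k) * sumDel A (λ _ → c)
    ≡⟨ cong (inv (suc k) *_) (trans (sumDel-const A c) (cong (λ a → ι a * c) eq)) ⟩
  inv (suc k) * (ι (suc k) * c)
    ≡⟨ *-assoc (inv (suc k)) (ι (suc k)) c ⟨
  inv (suc k) * ι (suc k) * c
    ≡⟨ cong (_* c) (inv-*-ι (suc k)) ⟩
  1ℚ * c
    ≡⟨ *-identityˡ c ⟩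
  c ∎
  where
  open ≤-Reasoning
  k = d ℕ.+ K

lubell-≤-c₀ : ∀ n → n ℕ.≥ 8 → ∀ F → Admissible n F → lubell n F ≤ c₀
lubell-≤-c₀ n n≥8 F (F! , ∅∈F , ¬copy) = subst (_≤ c₀) (lubellBelow-⊤ F)
  (lubellBelow-≤-max F F! ∅∈F ¬copy 8 c₀ (λ A → level-8 A refl) ∑inv≤c₀ (n ℕ.∸ 8) ⊤ (trans (∣⊤∣≡n n) (sym (ℕ.m∸n+n≡m n≥8))))
  where
  S = singletonsOf F
  level-8 : ∀ {k} (A : Subset n) → k ≡ 8 → ∣ A ∣ ≡ k → lubellBelow F A ≤ c₀
  level-8 {k} A k≡8 eq = ≤-trans (lubellBelow-≤-levelBound F F! ∅∈F ¬copy k A eq)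
    (levelBound≤c₀ k≡8 ∣ A ∩ S ∣ ∣ A ∩ ∁ S ∣ (trans (∣p∩q∣+∣p∩∁q∣≡∣p∣ A S) eq))

-- Enumeration of the subsets of a given size

subsetsOfSize : ∀ n → ℕ → List (Subset n)
subsetsOfSize zero    zero    = [ [] ]
subsetsOfSize zero    (suc k) = []
subsetsOfSize (suc n) zero    = map (outside ∷_) (subsetsOfSize n zero)
subsetsOfSize (suc n) (suc k) = map (inside ∷_) (subsetsOfSize n k) ++ map (outside ∷_) (subsetsOfSize n (suc k))

length-subsetsOfSize : ∀ n k → length (subsetsOfSize n k) ≡ n C k
length-subsetsOfSize zero    zero    = refl
length-subsetsOfSize zero    (suc k) = sym (0C k)
length-subsetsOfSize (suc n) zero    = trans (List.length-map _ (subsetsOfSize n zero)) (length-subsetsOfSize n zero)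
length-subsetsOfSize (suc n) (suc k) = begin
  length (map (inside ∷_) (subsetsOfSize n k) ++ map (outside ∷_) (subsetsOfSize n (suc k)))
    ≡⟨ List.length-++ (map (inside ∷_) (subsetsOfSize n k)) ⟩
  length (map (inside ∷_) (subsetsOfSize n k)) ℕ.+ length (map (outside ∷_) (subsetsOfSize n (suc k)))
    ≡⟨ cong₂ ℕ._+_ (trans (List.length-map _ (subsetsOfSize n k)) (length-subsetsOfSize n k))
                   (trans (List.length-map _ (subsetsOfSize n (suc k))) (length-subsetsOfSize n (suc k))) ⟩
  (n C k) ℕ.+ (n C suc k)
    ≡⟨ nCk+nC[k+1]≡[n+1]C[k+1] n k ⟩
  suc n C suc k ∎
  where open ≡-Reasoning

∈-subsetsOfSize⁻ : ∀ n k {p} → p ∈ subsetsOfSize n k → ∣ p ∣ ≡ k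
∈-subsetsOfSize⁻ zero    zero    {[]} _ = refl
∈-subsetsOfSize⁻ (suc n) zero    p∈ with q , q∈ , refl ← ∈-map⁻ (outside ∷_) p∈ = ∈-subsetsOfSize⁻ n zero q∈
∈-subsetsOfSize⁻ (suc n) (suc k) p∈ with ∈-++⁻ (map (inside ∷_) (subsetsOfSize n k)) p∈
... | inj₁ p∈ᵢ with q , q∈ , refl ← ∈-map⁻ (inside ∷_) p∈ᵢ  = cong suc (∈-subsetsOfSize⁻ n k q∈)
... | inj₂ p∈ₒ with q , q∈ , refl ← ∈-map⁻ (outside ∷_) p∈ₒ = ∈-subsetsOfSize⁻ n (suc k) q∈

∅∈subsetsOfSize : ∀ n → ∅ ∈ subsetsOfSize n 0
∅∈subsetsOfSize zero    = here refl
∅∈subsetsOfSize (suc n) = ∈-map⁺ (outside ∷_) (∅∈subsetsOfSize n)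

subsetsOfSize-unique : ∀ n k → Unique (subsetsOfSize n k)
subsetsOfSize-unique zero    zero    = [] ∷ []
subsetsOfSize-unique zero    (suc k) = []
subsetsOfSize-unique (suc n) zero    = Unique.map⁺ Vec.∷-injectiveʳ (subsetsOfSize-unique n zero)
subsetsOfSize-unique (suc n) (suc k) =
  Unique.++⁺ (Unique.map⁺ Vec.∷-injectiveʳ (subsetsOfSize-unique n k))
             (Unique.map⁺ Vec.∷-injectiveʳ (subsetsOfSize-unique n (suc k)))
             λ (p∈ᵢ , p∈ₒ) → disjoint (∈-map⁻ (inside ∷_) p∈ᵢ) (∈-map⁻ (outside ∷_) p∈ₒ)
  where
  disjoint : ∀ {p : Subset (suc n)} {xs ys} → (∃ λ q → q ∈ xs × p ≡ inside ∷ q) → ¬ (∃ λ q → q ∈ ys × p ≡ outside ∷ q)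
  disjoint (_ , _ , refl) (_ , _ , ())

length-cartesianProductWith : ∀ {A B C : Set} (f : A → B → C) xs ys →
                              length (cartesianProductWith f xs ys) ≡ length xs ℕ.* length ys
length-cartesianProductWith f []       ys = refl
length-cartesianProductWith f (x ∷ xs) ys = trans (List.length-++ (map (f x) ys))
  (cong₂ ℕ._+_ (List.length-map (f x) ys) (length-cartesianProductWith f xs ys))

-- Profiles and concatenation of subsets

Profile : Set
Profile = ℕ × ℕ × ℕ

take-++ : ∀ {A : Set} {m n} (xs : Vec A m) (ys : Vec A n) → Vec.take m (xs Vec.++ ys) ≡ xs
take-++ []       ys = refl
take-++ (x ∷ xs) ys = cong (x ∷_) (take-++ xs ys)

drop-++ : ∀ {A : Set} {m n} (xs : Vec A m) (ys : Vec A n) → Vec.drop m (xs Vec.++ ys) ≡ ys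
drop-++ []       ys = refl
drop-++ (x ∷ xs) ys = drop-++ xs ys

∣++∣ : ∀ {m n} (p : Subset m) (q : Subset n) → ∣ p Vec.++ q ∣ ≡ ∣ p ∣ ℕ.+ ∣ q ∣
∣++∣ []            q = refl
∣++∣ (inside  ∷ p) q = cong suc (∣++∣ p q)
∣++∣ (outside ∷ p) q = ∣++∣ p q

++-⊆ : ∀ {m n} {p p′ : Subset m} {q q′ : Subset n} → p ⊆ p′ → q ⊆ q′ → p Vec.++ q ⊆ p′ Vec.++ q′
++-⊆ {p = []}          {[]}     p⊆p′ q⊆q′ x∈ = q⊆q′ x∈
++-⊆ {p = inside ∷ p}  {s ∷ p′} p⊆p′ q⊆q′ here with here ← p⊆p′ here = here
++-⊆ {p = _ ∷ p}       {s ∷ p′} p⊆p′ q⊆q′ (there x∈) = there (++-⊆ (drop-∷-⊆ p⊆p′) q⊆q′ x∈)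

take-⊆ : ∀ m {n} {p q : Subset (m ℕ.+ n)} → p ⊆ q → Vec.take m p ⊆ Vec.take m q
take-⊆ (suc m) {p = _ ∷ p} {_ ∷ q} p⊆q here with here ← p⊆q here = here
take-⊆ (suc m) {p = _ ∷ p} {_ ∷ q} p⊆q (there x∈) = there (take-⊆ m (drop-∷-⊆ p⊆q) x∈)

drop-⊆ : ∀ m {n} {p q : Subset (m ℕ.+ n)} → p ⊆ q → Vec.drop m p ⊆ Vec.drop m q
drop-⊆ zero    p⊆q = p⊆q
drop-⊆ (suc m) {p = _ ∷ p} {_ ∷ q} p⊆q = drop-⊆ m (drop-∷-⊆ p⊆q)

lubell-++ : ∀ {n} (F G : List (Subset n)) → lubell n (F ++ G) ≡ lubell n F + lubell n G
lubell-++ []      G = sym (+-identityˡ _)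
lubell-++ {n} (A ∷ F) G = trans (cong (inv (n C ∣ A ∣) +_) (lubell-++ F G)) (sym (+-assoc (inv (n C ∣ A ∣)) _ _))

lubell-uniform : ∀ {n} k (F : List (Subset n)) → All (λ p → ∣ p ∣ ≡ k) F → lubell n F ≡ ι (length F) * inv (n C k)
lubell-uniform {n} k []      []           = sym (*-zeroˡ (inv (n C k)))
lubell-uniform {n} k (A ∷ F) (refl ∷ ks) = begin
  w + lubell n F               ≡⟨ cong (w +_) (lubell-uniform k F ks) ⟩
  w + ι (length F) * w         ≡⟨ solve 2 (λ l w → w :+ l :* w := (con 1ℚ :+ l) :* w) refl (ι (length F)) w ⟩
  (1ℚ + ι (length F)) * w      ≡⟨ cong (_* w) (ι-+ 1 (length F)) ⟨
  ι (suc (length F)) * w       ∎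
  where
  open ≡-Reasoning
  open +-*-Solver
  w = inv (n C k)

-- The eight profiles and their nestedness

profiles : List Profile
profiles = (0 , 0 , 0) ∷ (1 , 0 , 0) ∷ (1 , 1 , 0) ∷ (0 , 2 , 0) ∷ (0 , 0 , 2) ∷
           (1 , 1 , 1) ∷ (0 , 2 , 1) ∷ (0 , 1 , 2) ∷ []

_≤ₚ_ : Profile → Profile → Set
(i , j , k) ≤ₚ (i′ , j′ , k′) = i ℕ.≤ i′ × j ℕ.≤ j′ × k ℕ.≤ k′

_≤ₚ?_ : ∀ σ τ → Dec (σ ≤ₚ τ)
(i , j , k) ≤ₚ? (i′ , j′ , k′) = (i ℕ.≤? i′) ×-dec (j ℕ.≤? j′) ×-dec (k ℕ.≤? k′)

-- For parts x, y ⊆ z of sizes i, j, m this forces x ⊆ y.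
Nested : ℕ → ℕ → ℕ → Set
Nested m i j = i ≡ 0 ⊎ j ≡ m

Nestedₚ : Profile → Profile → Profile → Set
Nestedₚ (m₁ , m₂ , m₃) (i₁ , i₂ , i₃) (j₁ , j₂ , j₃) = Nested m₁ i₁ j₁ × Nested m₂ i₂ j₂ × Nested m₃ i₃ j₃

nested? : ∀ m i j → Dec (Nested m i j)
nested? m i j = (i ℕ.≟ 0) ⊎-dec (j ℕ.≟ m)

nestedₚ? : ∀ τ σ σ′ → Dec (Nestedₚ τ σ σ′)
nestedₚ? (m₁ , m₂ , m₃) (i₁ , i₂ , i₃) (j₁ , j₂ , j₃) = nested? m₁ i₁ j₁ ×-dec nested? m₂ i₂ j₂ ×-dec nested? m₃ i₃ j₃

-- A finite check over all triples of the eight profiles, independent of the sizes of the parts.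
-- Nestedness makes two members below a common one comparable, whatever their position.
profiles-nested : ∀ {τ σ σ′} → τ ∈ profiles → σ ∈ profiles → σ′ ∈ profiles → σ ≤ₚ τ → σ′ ≤ₚ τ →
                  Nestedₚ τ σ σ′ ⊎ Nestedₚ τ σ′ σ
profiles-nested τ∈ σ∈ σ′∈ = All.lookup (All.lookup (All.lookup check τ∈) σ∈) σ′∈
  where
  check = toWitness {a? = All.all? (λ τ → All.all? (λ σ → All.all? (λ σ′ →
    (σ ≤ₚ? τ) →-dec ((σ′ ≤ₚ? τ) →-dec (nestedₚ? τ σ σ′ ⊎-dec nestedₚ? τ σ′ σ))) profiles) profiles) profiles} _

nested⇒⊆ : ∀ {x y z : Subset n} → x ⊆ z → y ⊆ z → Nested (∣ z ∣) (∣ x ∣) (∣ y ∣) → x ⊆ y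
nested⇒⊆ {x = x} x⊆z y⊆z (inj₁ ∣x∣≡0) = subst (_⊆ _) (sym (∣p∣≡0⇒p≡⊥ x ∣x∣≡0)) ⊥⊆
nested⇒⊆ {x = x} x⊆z y⊆z (inj₂ ∣y∣≡∣z∣) = subst (x ⊆_) (sym (p⊆q∧∣p∣≡∣q∣⇒p≡q y⊆z ∣y∣≡∣z∣)) x⊆z

profiles-unique : Unique profiles
profiles-unique = toWitness {a? = AllPairs.allPairs? (λ σ τ → ¬? (σ ≟ₚ τ)) profiles} _
  where _≟ₚ_ = Product.≡-dec ℕ._≟_ (Product.≡-dec ℕ._≟_ ℕ._≟_)

∅-++ : ∀ m {n} → ∅ {m} Vec.++ ∅ {n} ≡ ∅
∅-++ zero    = refl
∅-++ (suc m) = cong (outside ∷_) (∅-++ m)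

-- The family built from layers of fixed profile

module _ (a b c : ℕ) where

  part₁ : Subset (a ℕ.+ (b ℕ.+ c)) → Subset a
  part₁ = Vec.take a

  part₂ : Subset (a ℕ.+ (b ℕ.+ c)) → Subset b
  part₂ = Vec.take b ∘ Vec.drop a

  part₃ : Subset (a ℕ.+ (b ℕ.+ c)) → Subset c
  part₃ = Vec.drop b ∘ Vec.drop a

  profile : Subset (a ℕ.+ (b ℕ.+ c)) → Profile
  profile p = ∣ part₁ p ∣ , ∣ part₂ p ∣ , ∣ part₃ p ∣

  layer : Profile → List (Subset (a ℕ.+ (b ℕ.+ c)))
  layer (i , j , k) =
    cartesianProductWith Vec._++_ (subsetsOfSize a i)
      (cartesianProductWith Vec._++_ (subsetsOfSize b j) (subsetsOfSize c k))

  layer-profile : ∀ τ {p} → p ∈ layer τ → profile p ≡ τ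
  layer-profile (i , j , k) p∈
    with x , yz , x∈ , yz∈ , refl ← ∈-cartesianProductWith⁻ Vec._++_ (subsetsOfSize a i) _ p∈
    with y , z , y∈ , z∈ , refl ← ∈-cartesianProductWith⁻ Vec._++_ (subsetsOfSize b j) (subsetsOfSize c k) yz∈
    rewrite take-++ x (y Vec.++ z) | drop-++ x (y Vec.++ z) | take-++ y z | drop-++ y z
          | ∈-subsetsOfSize⁻ a i x∈ | ∈-subsetsOfSize⁻ b j y∈ | ∈-subsetsOfSize⁻ c k z∈ = refl

  layer-size : ∀ i j k → All (λ p → ∣ p ∣ ≡ i ℕ.+ (j ℕ.+ k)) (layer (i , j , k))
  layer-size i j k = All.tabulate size
    where
    size : ∀ {p} → p ∈ layer (i , j , k) → ∣ p ∣ ≡ i ℕ.+ (j ℕ.+ k)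
    size p∈
      with x , yz , x∈ , yz∈ , refl ← ∈-cartesianProductWith⁻ Vec._++_ (subsetsOfSize a i) _ p∈
      with y , z , y∈ , z∈ , refl ← ∈-cartesianProductWith⁻ Vec._++_ (subsetsOfSize b j) (subsetsOfSize c k) yz∈
      = trans (∣++∣ x (y Vec.++ z)) (cong₂ ℕ._+_ (∈-subsetsOfSize⁻ a i x∈)
          (trans (∣++∣ y z) (cong₂ ℕ._+_ (∈-subsetsOfSize⁻ b j y∈) (∈-subsetsOfSize⁻ c k z∈))))

  layer-unique : ∀ τ → Unique (layer τ)
  layer-unique (i , j , k) =
    Unique.cartesianProductWith⁺ Vec._++_ (Vec.++-injective _ _) (subsetsOfSize-unique a i)
      (Unique.cartesianProductWith⁺ Vec._++_ (Vec.++-injective _ _) (subsetsOfSize-unique b j) (subsetsOfSize-unique c k))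

  length-layer : ∀ i j k → length (layer (i , j , k)) ≡ (a C i) ℕ.* ((b C j) ℕ.* (c C k))
  length-layer i j k = trans (length-cartesianProductWith Vec._++_ (subsetsOfSize a i) _)
    (cong₂ ℕ._*_ (length-subsetsOfSize a i)
      (trans (length-cartesianProductWith Vec._++_ (subsetsOfSize b j) (subsetsOfSize c k))
        (cong₂ ℕ._*_ (length-subsetsOfSize b j) (length-subsetsOfSize c k))))

  layers : List Profile → List (Subset (a ℕ.+ (b ℕ.+ c)))
  layers τs = concat (map layer τs)

  -- A set has only one profile, so layers of distinct profiles are disjoint.
  layers-unique : ∀ {τs} → Unique τs → Unique (layers τs)
  layers-unique τs! = Unique.concat⁺ (All.map⁺ (All.tabulate λ {τ} _ → layer-unique τ))
    (AllPairs.map⁺ (AllPairs.map (λ {τ} {τ′} τ≢τ′ {_} (p∈ , p∈′) → τ≢τ′ (trans (sym (layer-profile τ p∈)) (layer-profile τ′ p∈′))) τs!))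

  ∈-layers⁻ : ∀ τs {p} → p ∈ layers τs → profile p ∈ τs
  ∈-layers⁻ (τ ∷ τs) p∈ with ∈-++⁻ (layer τ) p∈
  ... | inj₁ p∈τ  = here (layer-profile τ p∈τ)
  ... | inj₂ p∈τs = there (∈-layers⁻ τs p∈τs)

  part₁-⊆ : ∀ {p q : Subset (a ℕ.+ (b ℕ.+ c))} → p ⊆ q → part₁ p ⊆ part₁ q
  part₁-⊆ = take-⊆ a

  part₂-⊆ : ∀ {p q : Subset (a ℕ.+ (b ℕ.+ c))} → p ⊆ q → part₂ p ⊆ part₂ q
  part₂-⊆ {p} {q} p⊆q = take-⊆ b {p = Vec.drop a p} {Vec.drop a q} (drop-⊆ a {p = p} {q} p⊆q)

  part₃-⊆ : ∀ {p q : Subset (a ℕ.+ (b ℕ.+ c))} → p ⊆ q → part₃ p ⊆ part₃ q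
  part₃-⊆ {p} {q} p⊆q = drop-⊆ b {p = Vec.drop a p} {Vec.drop a q} (drop-⊆ a {p = p} {q} p⊆q)

  profile-mono : ∀ {p q : Subset (a ℕ.+ (b ℕ.+ c))} → p ⊆ q → profile p ≤ₚ profile q
  profile-mono {p} {q} p⊆q = p⊆q⇒∣p∣≤∣q∣ (part₁-⊆ {p} {q} p⊆q) , p⊆q⇒∣p∣≤∣q∣ (part₂-⊆ {p} {q} p⊆q) , p⊆q⇒∣p∣≤∣q∣ (part₃-⊆ {p} {q} p⊆q)

  parts-⊆ : ∀ {p q : Subset (a ℕ.+ (b ℕ.+ c))} →
            part₁ p ⊆ part₁ q → part₂ p ⊆ part₂ q →
            part₃ p ⊆ part₃ q → p ⊆ q
  parts-⊆ {p} {q} ⊆₁ ⊆₂ ⊆₃ = subst₂ _⊆_ (rejoin p) (rejoin q) (++-⊆ ⊆₁ (++-⊆ ⊆₂ ⊆₃))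
    where
    rejoin : ∀ r → part₁ r Vec.++ (part₂ r Vec.++ part₃ r) ≡ r
    rejoin r = trans (cong (part₁ r Vec.++_) (Vec.take++drop≡id b (Vec.drop a r))) (Vec.take++drop≡id a r)

  nestedₚ⇒⊆ : ∀ {x y z : Subset (a ℕ.+ (b ℕ.+ c))} → x ⊆ z → y ⊆ z →
              Nestedₚ (profile z) (profile x) (profile y) → x ⊆ y
  nestedₚ⇒⊆ {x} {y} {z} x⊆z y⊆z (n₁ , n₂ , n₃) = parts-⊆ {x} {y}
    (nested⇒⊆ (part₁-⊆ {x} {z} x⊆z) (part₁-⊆ {y} {z} y⊆z) n₁)
    (nested⇒⊆ (part₂-⊆ {x} {z} x⊆z) (part₂-⊆ {y} {z} y⊆z) n₂)
    (nested⇒⊆ (part₃-⊆ {x} {z} x⊆z) (part₃-⊆ {y} {z} y⊆z) n₃)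

  family : List (Subset (a ℕ.+ (b ℕ.+ c)))
  family = layers profiles

  -- The two middle sets of a copy lie below its top, so `profiles-nested` puts one inside the
  -- other. The embedding reflects this to an inclusion between the two atoms of the diamond, which
  -- is false.
  family-diamondFree : ¬ ContainsCopyOfB 2 (family)
  family-diamondFree (f , f∈ , f-emb) =
    [ (λ nested → l⊈r (reflect l r (nestedₚ⇒⊆ {x = f l} {f r} {f t} l⊆t r⊆t nested)))
    , (λ nested → r⊈l (reflect r l (nestedₚ⇒⊆ {x = f r} {f l} {f t} r⊆t l⊆t nested)))
    ]′ (profiles-nested (∈-layers⁻ profiles (f∈ t)) (∈-layers⁻ profiles (f∈ l)) (∈-layers⁻ profiles (f∈ r))
         (profile-mono {p = f l} {f t} l⊆t) (profile-mono {p = f r} {f t} r⊆t))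
    where
    l r t : Subset 2
    l = inside ∷ outside ∷ []
    r = outside ∷ inside ∷ []
    t = inside ∷ inside ∷ []
    l⊆t : f l ⊆ f t
    l⊆t = Equivalence.to (f-emb l t) ⊆⊤
    r⊆t : f r ⊆ f t
    r⊆t = Equivalence.to (f-emb r t) ⊆⊤
    reflect : ∀ x y → f x ⊆ f y → x ⊆ y
    reflect x y = Equivalence.from (f-emb x y)
    l⊈r : ¬ l ⊆ r
    l⊈r l⊆r = contradiction (l⊆r here) λ ()
    r⊈l : ¬ r ⊆ l
    r⊈l r⊆l = contradiction (r⊆l (there here)) λ { (there ()) }

  family-admissible : Admissible (a ℕ.+ (b ℕ.+ c)) (family)
  family-admissible = layers-unique profiles-unique , ∅∈ , family-diamondFree
    where
    ∅∈ : ∅ ∈ family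
    -- The profile (0, 0, 0) heads the list, so ∅ is found in the first layer.
    ∅∈ = ∈-++⁺ˡ (subst (_∈ layer (0 , 0 , 0)) (trans (cong (∅ {a} Vec.++_) (∅-++ b {c})) (∅-++ a {b ℕ.+ c}))
      (∈-cartesianProductWith⁺ Vec._++_ (∅∈subsetsOfSize a) (∈-cartesianProductWith⁺ Vec._++_ (∅∈subsetsOfSize b) (∅∈subsetsOfSize c))))

-- Lubell mass of the layers

size : Profile → ℕ
size (i , j , k) = i ℕ.+ (j ℕ.+ k)

module _ (a b c : ℕ) where

  private
    n₀ = a ℕ.+ (b ℕ.+ c)

  -- By r! (n choose r) ≤ nʳ, a lower bound for n³ times the Lubell mass of a layer.
  layerMass : Profile → ℕ
  layerMass τ@(i , j , k) = size τ ! ℕ.* n₀ ℕ.^ (3 ℕ.∸ size τ) ℕ.* ((a C i) ℕ.* ((b C j) ℕ.* (c C k)))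

  -- All sets of a layer have the same size r, so its Lubell function is a single fraction.
  -- Cross-multiplication reduces the claim to `k!*nCk≤n^k`, and the power 3 - r brings every layer
  -- to the denominator n³.
  layerMass-≤-lubell : 3 ℕ.≤ n₀ → ∀ τ → size τ ℕ.≤ 3 → ι (layerMass τ) * inv (n₀ ℕ.^ 3) ≤ lubell n₀ (layer a b c τ)
  layerMass-≤-lubell 3≤n τ@(i , j , k) r≤3 = begin
    ι (layerMass τ) * inv (n₀ ℕ.^ 3)
      ≤⟨ ι*inv-mono-≤ (layerMass τ) (n₀ ℕ.^ 3) N (n₀ C r)
           {{ℕ.m^n≢0 n₀ 3 {{ℕ.>-nonZero (ℕ.≤-trans (s≤s z≤n) 3≤n)}}}} {{nCk≢0 (ℕ.≤-trans r≤3 3≤n)}} mass ⟩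
    ι N * inv (n₀ C r)
      ≡⟨ cong (λ l → ι l * inv (n₀ C r)) (length-layer a b c i j k) ⟨
    ι (length (layer a b c τ)) * inv (n₀ C r)
      ≡⟨ lubell-uniform r (layer a b c τ) (layer-size a b c i j k) ⟨
    lubell n₀ (layer a b c τ) ∎
    where
    open ≤-Reasoning
    r = size τ
    N = (a C i) ℕ.* ((b C j) ℕ.* (c C k))
    mass : layerMass τ ℕ.* (n₀ C r) ℕ.≤ N ℕ.* n₀ ℕ.^ 3
    mass = ℕ≤.begin
      r ! ℕ.* n₀ ℕ.^ (3 ℕ.∸ r) ℕ.* N ℕ.* (n₀ C r)
        ℕ≤.≡⟨ solve 4 (λ f e N C → f :* e :* N :* C := N :* (e :* (f :* C)))
             refl (r !) (n₀ ℕ.^ (3 ℕ.∸ r)) N (n₀ C r) ⟩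
      N ℕ.* (n₀ ℕ.^ (3 ℕ.∸ r) ℕ.* (r ! ℕ.* (n₀ C r)))
        ℕ≤.≤⟨ ℕ.*-monoʳ-≤ N (ℕ.*-monoʳ-≤ (n₀ ℕ.^ (3 ℕ.∸ r)) (k!*nCk≤n^k n₀ r)) ⟩
      N ℕ.* (n₀ ℕ.^ (3 ℕ.∸ r) ℕ.* n₀ ℕ.^ r)
        ℕ≤.≡⟨ cong (N ℕ.*_) (trans (sym (ℕ.^-distribˡ-+-* n₀ (3 ℕ.∸ r) r)) (cong (n₀ ℕ.^_) (ℕ.m∸n+n≡m r≤3))) ⟩
      N ℕ.* n₀ ℕ.^ 3 ℕ≤.∎
      where
      module ℕ≤ = ℕ.≤-Reasoning
      open ℕSolver.+-*-Solver

  layerMasses-≤-lubell : 3 ℕ.≤ n₀ → ∀ {τs} → All (λ τ → size τ ℕ.≤ 3) τs →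
                         ι (sum (map layerMass τs)) * inv (n₀ ℕ.^ 3) ≤ lubell n₀ (layers a b c τs)
  layerMasses-≤-lubell 3≤n [] = ≤-reflexive (*-zeroˡ (inv (n₀ ℕ.^ 3)))
  layerMasses-≤-lubell 3≤n {τ ∷ τs} (r≤3 ∷ rs≤3) = begin
    ι (layerMass τ ℕ.+ sum (map layerMass τs)) * v
      ≡⟨ cong (_* v) (ι-+ (layerMass τ) _) ⟩
    (ι (layerMass τ) + ι (sum (map layerMass τs))) * v
      ≡⟨ *-distribʳ-+ v (ι (layerMass τ)) _ ⟩
    ι (layerMass τ) * v + ι (sum (map layerMass τs)) * v
      ≤⟨ +-mono-≤ (layerMass-≤-lubell 3≤n τ r≤3) (layerMasses-≤-lubell 3≤n rs≤3) ⟩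
    lubell n₀ (layer a b c τ) + lubell n₀ (layers a b c τs)
      ≡⟨ lubell-++ (layer a b c τ) _ ⟨
    lubell n₀ (layers a b c (τ ∷ τs)) ∎
    where
    open ≤-Reasoning
    v = inv (n₀ ℕ.^ 3)

-- The total mass as a cubic form

2*nC2+n≡n*n : ∀ n → 2 ℕ.* (n C 2) ℕ.+ n ≡ n ℕ.* n
2*nC2+n≡n*n zero = refl
2*nC2+n≡n*n (suc n) = begin
  2 ℕ.* (suc n C 2) ℕ.+ suc n    ≡⟨ cong (ℕ._+ suc n) ([1+k]*[1+n]C[1+k]≡[1+n]*nCk n 1) ⟩
  suc n ℕ.* (n C 1) ℕ.+ suc n    ≡⟨ cong (λ x → suc n ℕ.* x ℕ.+ suc n) (nC1≡n n) ⟩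
  suc n ℕ.* n ℕ.+ suc n          ≡⟨ ℕ.+-comm (suc n ℕ.* n) (suc n) ⟩
  suc n ℕ.+ suc n ℕ.* n          ≡⟨ ℕ.*-suc (suc n) n ⟨
  suc n ℕ.* suc n                ∎
  where open ≡-Reasoning

-- The right side is what the masses would add up to if 2 (b choose 2) were b² and 2 (c choose 2)
-- were c². The summand added on the left makes up for the missing b and c.
layerMasses-total : ∀ a b c → let n = a ℕ.+ (b ℕ.+ c) in
  sum (map (layerMass a b c) profiles) ℕ.+ (n ℕ.* (b ℕ.+ c) ℕ.+ 6 ℕ.* (b ℕ.* c))
  ≡ n ℕ.* (n ℕ.* n) ℕ.+ n ℕ.* (n ℕ.* a) ℕ.+ n ℕ.* (2 ℕ.* (a ℕ.* b) ℕ.+ b ℕ.* b ℕ.+ c ℕ.* c)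
    ℕ.+ 3 ℕ.* (2 ℕ.* (a ℕ.* (b ℕ.* c)) ℕ.+ b ℕ.* b ℕ.* c ℕ.+ b ℕ.* (c ℕ.* c))
layerMasses-total a b c
  -- Squares of b and c are expressed through b choose 2 and c choose 2, which leaves a polynomial
  -- identity in five independent variables.
  rewrite sym (2*nC2+n≡n*n b) | sym (2*nC2+n≡n*n c) | nC1≡n a | nC1≡n b | nC1≡n c =
  solve 5 (λ a b c β γ → let n = a :+ (b :+ c) ; b² = con 2 :* β :+ b ; c² = con 2 :* γ :+ c in
    con 1 :* (n :* (n :* (n :* con 1))) :* (con 1 :* (con 1 :* con 1))
    :+ (con 1 :* (n :* (n :* con 1)) :* (a :* (con 1 :* con 1))
    :+ (con 2 :* (n :* con 1) :* (a :* (b :* con 1))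
    :+ (con 2 :* (n :* con 1) :* (con 1 :* (β :* con 1))
    :+ (con 2 :* (n :* con 1) :* (con 1 :* (con 1 :* γ))
    :+ (con 6 :* con 1 :* (a :* (b :* c))
    :+ (con 6 :* con 1 :* (con 1 :* (β :* c))
    :+ (con 6 :* con 1 :* (con 1 :* (b :* γ)) :+ con 0)))))))
    :+ (n :* (b :+ c) :+ con 6 :* (b :* c))
    := n :* (n :* n) :+ n :* (n :* a) :+ n :* (con 2 :* (a :* b) :+ b² :+ c²)
       :+ con 3 :* (con 2 :* (a :* (b :* c)) :+ b² :* c :+ b :* c²)) refl a b c (b C 2) (c C 2)
  where open ℕSolver.+-*-Solver

-- 3652264 = 154³, and the total mass is the value 8333942 m³ of the cubic form in layerMasses-total less 35778 m².
mass-bound : ∀ p q d m → p ℕ.* 3652264 ℕ.+ d ≡ 8333942 ℕ.* q → 35778 ℕ.* q ℕ.≤ d ℕ.* m →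
             let a = 37 ℕ.* m ; b = 80 ℕ.* m in
             p ℕ.* (a ℕ.+ (b ℕ.+ a)) ℕ.^ 3 ℕ.≤ sum (map (layerMass a b a) profiles) ℕ.* q
mass-bound p q d m gap m-large = ℕ.+-cancelʳ-≤ (35778 ℕ.* (m ℕ.* m) ℕ.* q) (p ℕ.* n₀ ℕ.^ 3) (T ℕ.* q) (begin
  p ℕ.* n₀ ℕ.^ 3 ℕ.+ 35778 ℕ.* (m ℕ.* m) ℕ.* q
    ≡⟨ solve 3 (λ p q m → let n = con 37 :* m :+ (con 80 :* m :+ con 37 :* m) in
         p :* (n :* (n :* (n :* con 1))) :+ con 35778 :* (m :* m) :* q
         := p :* con 3652264 :* (m :* (m :* m)) :+ con 35778 :* q :* (m :* m)) refl p q m ⟩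
  p ℕ.* 3652264 ℕ.* (m ℕ.* (m ℕ.* m)) ℕ.+ 35778 ℕ.* q ℕ.* (m ℕ.* m)
    -- For large m the slack d, which is multiplied by m³, pays for the loss of order m².
    ≤⟨ ℕ.+-monoʳ-≤ (p ℕ.* 3652264 ℕ.* (m ℕ.* (m ℕ.* m))) (ℕ.*-monoˡ-≤ (m ℕ.* m) m-large) ⟩
  p ℕ.* 3652264 ℕ.* (m ℕ.* (m ℕ.* m)) ℕ.+ d ℕ.* m ℕ.* (m ℕ.* m)
    ≡⟨ solve 3 (λ x d m → x :* (m :* (m :* m)) :+ d :* m :* (m :* m) := (x :+ d) :* (m :* (m :* m)))
         refl (p ℕ.* 3652264) d m ⟩
  (p ℕ.* 3652264 ℕ.+ d) ℕ.* (m ℕ.* (m ℕ.* m))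
    ≡⟨ cong (ℕ._* (m ℕ.* (m ℕ.* m))) gap ⟩
  8333942 ℕ.* q ℕ.* (m ℕ.* (m ℕ.* m))
    ≡⟨ solve 2 (λ q m → let a = con 37 :* m ; b = con 80 :* m ; n = a :+ (b :+ a) in
         con 8333942 :* q :* (m :* (m :* m))
         := (n :* (n :* n) :+ n :* (n :* a) :+ n :* (con 2 :* (a :* b) :+ b :* b :+ a :* a)
             :+ con 3 :* (con 2 :* (a :* (b :* a)) :+ b :* b :* a :+ b :* (a :* a))) :* q) refl q m ⟩
  (n₀ ℕ.* (n₀ ℕ.* n₀) ℕ.+ n₀ ℕ.* (n₀ ℕ.* a) ℕ.+ n₀ ℕ.* (2 ℕ.* (a ℕ.* b) ℕ.+ b ℕ.* b ℕ.+ a ℕ.* a)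
    ℕ.+ 3 ℕ.* (2 ℕ.* (a ℕ.* (b ℕ.* a)) ℕ.+ b ℕ.* b ℕ.* a ℕ.+ b ℕ.* (a ℕ.* a))) ℕ.* q
    ≡⟨ cong (ℕ._* q) (layerMasses-total a b a) ⟨
  (T ℕ.+ (n₀ ℕ.* (b ℕ.+ a) ℕ.+ 6 ℕ.* (b ℕ.* a))) ℕ.* q
    ≡⟨ solve 3 (λ T q m → let a = con 37 :* m ; b = con 80 :* m ; n = a :+ (b :+ a) in
         (T :+ (n :* (b :+ a) :+ con 6 :* (b :* a))) :* q := T :* q :+ con 35778 :* (m :* m) :* q) refl T q m ⟩
  T ℕ.* q ℕ.+ 35778 ℕ.* (m ℕ.* m) ℕ.* q ∎)
  where
  open ℕ.≤-Reasoning
  open ℕSolver.+-*-Solver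
  a = 37 ℕ.* m
  b = 80 ℕ.* m
  n₀ = a ℕ.+ (b ℕ.+ a)
  T = sum (map (layerMass a b a) profiles)

-- A value strictly between 2.2818564 and the limit 2.28185640468....
c₁ : ℚ
c₁ = ι 2281856402 * inv 1000000000

-- Here d measures how far p/q stays below the limit 8333942 / 3652264, and m is taken so large that
-- the quadratic loss fits into this slack.
family-lubell : ∀ p q d m → .{{ℕ.NonZero q}} → p ℕ.* 3652264 ℕ.+ d ≡ 8333942 ℕ.* q → 35778 ℕ.* q ℕ.≤ d ℕ.* m → 3 ℕ.≤ m →
                let a = 37 ℕ.* m ; b = 80 ℕ.* m in
                ι p * inv q ≤ lubell (a ℕ.+ (b ℕ.+ a)) (family a b a)
family-lubell p q d m {{q≢0}} gap m-large 3≤m = ≤-trans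
  (ι*inv-mono-≤ p q (sum (map (layerMass a b a) profiles)) (n₀ ℕ.^ 3)
    {{q≢0}} {{ℕ.m^n≢0 n₀ 3 {{ℕ.>-nonZero (ℕ.≤-trans (s≤s z≤n) 3≤n₀)}}}} (mass-bound p q d m gap m-large))
  (layerMasses-≤-lubell a b a 3≤n₀ (toWitness {a? = All.all? (λ τ → size τ ℕ.≤? 3) profiles} _))
  where
  a = 37 ℕ.* m
  b = 80 ℕ.* m
  n₀ = a ℕ.+ (b ℕ.+ a)
  3≤n₀ : 3 ℕ.≤ n₀
  3≤n₀ = ℕ.≤-trans 3≤m (ℕ.≤-trans (ℕ.m≤n*m m 37) (ℕ.m≤m+n a (b ℕ.+ a)))

-- The two bounds

lowerBound : LowerBoundRhoStarDiamond (ℤ.+ 22818564 / 10000000)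
lowerBound = c₁ , toWitness {a? = (ℤ.+ 22818564 / 10000000) <? c₁} _ ,
  -- With this choice m is at least N and also at least 4000000.
  λ N → unbounded (N ℕ.+ 4000000) (ℕ.m≤m+n N 4000000) (ℕ.m≤n+m 4000000 N)
  where
  unbounded : ∀ {N} m → N ℕ.≤ m → 4000000 ℕ.≤ m → ∃ λ n → n ℕ.≥ N × ∃ λ F → Admissible n F × c₁ ≤ lubell n F
  unbounded m N≤m m₀≤m = a ℕ.+ (b ℕ.+ a) , ℕ.≤-trans N≤m (ℕ.≤-trans (ℕ.m≤n*m m 37) (ℕ.m≤m+n a (b ℕ.+ a))) ,
    -- The slack is 9805872 = 8333942 · 10⁹ - 2281856402 · 3652264, and 35778 · 10⁹ divided by it is
    -- below 4000000.
    family a b a , family-admissible a b a , family-lubell 2281856402 1000000000 9805872 m refl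
      (ℕ.≤-trans (ℕ.≤ᵇ⇒≤ (35778 ℕ.* 1000000000) (9805872 ℕ.* 4000000) _) (ℕ.*-monoʳ-≤ 9805872 m₀≤m))
      (ℕ.≤-trans (ℕ.≤ᵇ⇒≤ 3 4000000 _) m₀≤m)
    where
    a = 37 ℕ.* m
    b = 80 ℕ.* m

upperBound : UpperBoundRhoStarDiamond (ℤ.+ 25823284 / 10000000)
upperBound = c₀ , toWitness {a? = c₀ <? (ℤ.+ 25823284 / 10000000)} _ , 8 , lubell-≤-c₀

open import Data.Integer using (+_)

theorem4p4 : LowerBoundRhoStarDiamond (+ 22818564 / 10000000)
    × UpperBoundRhoStarDiamond (+ 25823284 / 10000000)
theorem4p4 = lowerBound , upperBound
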